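{- Let $0<\varepsilon<1/2$. Consider the following one-way two-party communication problem. There is a text $T$ of length $2n$ and a pattern $P$ of length $n$. Alice holds the first half $T[1,n]$ of the text and the whole pattern $P$; Bob holds the second half $T[n+1,2n]$ of the text and the whole pattern $P$. Alice sends a single message to Bob, after which Bob must output, for every alignment $i\in\{1,\dots,n+1\}$, a $(1+\varepsilon)$-approximation of the Hamming distance between $P$ and $T[i,i+n-1]$. This problem has one-way randomised communication complexity $\mathcal{O}(\varepsilon^{ -4}\log^2 n)$ bits.
   Context: The Hamming distance between two strings of equal length is the number of positions at which they differ. A $(1+\varepsilon)$-approximation of a nonnegative quantity $h$ is a value $h'$ with $h\le h'\le(1+\varepsilon)h$. Randomised communication complexity here allows the players to use randomness, with the protocol required to succeed with constant probability. Throughout the paper it is assumed that $\varepsilon<1/2$. -}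

module Defs where

open import Data.Nat using (ℕ; zero; suc)
import Data.Nat as N
open import Data.Bool using (Bool)
open import Data.Fin using (Fin; toℕ)
open import Data.Fin.Properties using (all?)
open import Data.List using (List; []; _∷_; take; drop; filter; length; allFin)
open import Data.Vec using (Vec; toList; _++_)
open import Data.Product using (_×_; _,_)
open import Data.Rational using (ℚ; 1ℚ)
open import Data.Integer using (+_)
import Data.Rational as Q
open import Data.Rational.Properties using (_≤?_)
open import Relation.Nullary using (Dec; yes; no)
open import Relation.Nullary.Decidable using (_×-dec_)
open import Relation.Unary using (Pred; Decidable)
open import Relation.Binary.Definitions using (DecidableEquality)

-- Hamming distance between two lists: number of mismatching positions
-- (only ever applied to lists of equal length n).
hamming : {A : Set} → DecidableEquality A → List A → List A → ℕ
hamming _≟_ [] [] = 0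
hamming _≟_ [] (_ ∷ _) = 0
hamming _≟_ (_ ∷ _) [] = 0
hamming _≟_ (x ∷ xs) (y ∷ ys) with x ≟ y
... | yes _ = hamming _≟_ xs ys
... | no _ = suc (hamming _≟_ xs ys)

-- Window T[i+1 .. i+n] of the text (alignment i is 0-based here).
window : {A : Set} → ℕ → ℕ → List A → List A
window n i T = take n (drop i T)

toℚ : ℕ → ℚ
toℚ h = (+ h) Q./ 1

IsApprox : ℚ → ℕ → ℚ → Set
IsApprox ε h h' = (toℚ h Q.≤ h') × (h' Q.≤ (1ℚ Q.+ ε) Q.* toℚ h)

isApprox? : ∀ ε h h' → Dec (IsApprox ε h h')
isApprox? ε h h' = (toℚ h ≤? h') ×-dec (h' ≤? (1ℚ Q.+ ε) Q.* toℚ h)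

count : {R : ℕ} {P : Pred (Fin R) Agda.Primitive.lzero} → Decidable P → ℕ
count {R} P? = length (filter P? (allFin R))

-- A public-coin one-way protocol over alphabet A, pattern/half-text length n,
-- R equally likely random strings (shared by both players) and messages of
-- exactly L bits.  Alice sees (r, T[1,n], P); Bob sees (r, message, T[n+1,2n], P)
-- and outputs one rational value per alignment i ∈ {0..n} (0-based).
record OneWayProtocol (A : Set) (n R L : ℕ) : Set where
  field
    alice : Fin R → Vec A n → Vec A n → Vec Bool L
    bob   : Fin R → Vec Bool L → Vec A n → Vec A n → Fin (suc n) → ℚ
open OneWayProtocol public

module _ {A : Set} (_≟_ : DecidableEquality A) {n R L : ℕ} (ε : ℚ)
         (Π : OneWayProtocol A n R L) (T₁ T₂ P : Vec A n) where

  Correct : Fin R → Set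
  Correct r = ∀ (i : Fin (suc n)) →
    IsApprox ε (hamming _≟_ (toList P) (window n (toℕ i) (toList (T₁ ++ T₂))))
               (bob Π r (alice Π r T₁ P) T₂ P i)

  correct? : Decidable Correct
  correct? r = all? (λ i → isApprox? ε (ham i) (bob Π r (alice Π r T₁ P) T₂ P i))
    where
    ham : Fin (suc n) → ℕ
    ham i = hamming _≟_ (toList P) (window n (toℕ i) (toList (T₁ ++ T₂)))

  successes : ℕ
  successes = count correct?

-- Π succeeds with probability ≥ 2/3 on every input (uniform r ∈ Fin R)
Succeeds : {A : Set} → DecidableEquality A → {n R L : ℕ} → ℚ → OneWayProtocol A n R L → Set
Succeeds {A} _≟_ {n} {R} ε Π =
  ∀ (T₁ T₂ P : Vec A n) → 2 N.* R N.≤ 3 N.* successes _≟_ ε Π T₁ T₂ P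

{-# OPTIONS --safe #-}
-- The protocol is deterministic. Alice knows the distance d i between T[i..n] and the prefix of P under
-- it; Bob knows the remaining distance exactly, so d has to be described to him. For every scale
-- k ∈ {0, 1, 2, 4, ...} Alice sends the first alignment a with d a ≤ k, which tells Bob T[a..n] up to k
-- mismatches. Encode strings as 0/1 vectors indexed by (position, symbol), write P_i for the pattern
-- placed at i, and put u = P_a - T on [a..n] and v i = P_i - P_a on [i..n]. Then
--   d i = (mismatches of T and P_a on [i..n]) + (mismatches of P_a and P_i on [i..n]) + ⟨ u , v i ⟩.
-- Bob knows the second term. The first is monotone in i and at most k, so N thresholds give it up to
-- k / N. For the third, ‖ u ‖² and ‖ v i ‖² are at most 4 k when d i ≤ k, and a perceptron argument
-- approximates N u by a signed sum of at most N² vectors v j with an error of at most 4 k in every inner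
-- product. Dividing by N, the error is O(k / N), which is at most ε d i at the scale k with
-- d i ≤ k ≤ 2 d i once N = O(1 / ε). All scales give upper bounds, so Bob takes the smallest. The message
-- has O(log n) scales with O(N²) numbers of O(log n) bits each, that is O(ε⁻² log² n) bits.
module Submission where

open import Defs
open import Data.Nat using (ℕ; zero; suc)
import Data.Nat as N
import Data.Nat.Properties as ℕ
import Data.Nat.DivMod as DM
open import Data.Nat.Induction using (<-rec)
open import Data.Nat.Logarithm using (⌈log₂_⌉; ⌈log₂⌉-mono-≤; ⌈log₂⌈n/2⌉⌉≡⌈log₂n⌉∸1)
import Data.Nat.Tactic.RingSolver as ℕSolver
open import Data.Integer using (ℤ; +_; -_; _+_; _-_; _*_; _≤_; _<_; ∣_∣; 0ℤ; 1ℤ; -1ℤ; _⊓_; +≤+)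
import Data.Integer as Z
import Data.Integer.Properties as ℤ
open import Data.Integer.Tactic.RingSolver using (solve-∀)
open import Data.Rational using (ℚ; mkℚ; 0ℚ; 1ℚ; ½; toℚᵘ)
import Data.Rational as Q
import Data.Rational.Properties as ℚ
import Data.Rational.Unnormalised as U
import Data.Rational.Unnormalised.Properties as ℚᵘ
open import Data.Bool using (Bool; true; false)
open import Data.Empty using (⊥-elim)
open import Data.Fin using (Fin; zero; suc; toℕ; fromℕ; fromℕ<; inject₁; inject≤; combine; remQuot)
import Data.Fin.Properties as Fin
open import Data.List as List using (List; []; _∷_; upTo; cartesianProduct; deduplicate; length)
import Data.List.Properties as List
open import Data.List.Membership.Propositional using (_∈_)
open import Data.List.Membership.Propositional.Properties using (∈-deduplicate⁺)
open import Data.List.Relation.Unary.All as All using (All; []; _∷_)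
open import Data.List.Relation.Unary.AllPairs using ([]; _∷_)
open import Data.List.Relation.Unary.Any using (here; there)
open import Data.List.Relation.Unary.Unique.Propositional using (Unique)
open import Data.List.Relation.Unary.Unique.DecPropositional.Properties using (deduplicate-!)
open import Data.Product using (Σ; ∃; _×_; _,_; proj₁; proj₂)
open import Data.Vec using (Vec; []; _∷_; _++_; take; drop; replicate; head; toList; tabulate; lookup)
import Data.Vec.Properties as Vec
open import Relation.Nullary using (Dec; yes; no; ¬_)
open import Relation.Nullary.Decidable using (_×-dec_)
open import Relation.Unary using (Decidable)
open import Relation.Binary.Definitions using (DecidableEquality)
open import Relation.Binary.PropositionalEquality using (_≡_; _≢_; refl; sym; trans; cong; cong₂; subst; subst₂; module ≡-Reasoning)

-- Integer inequalities and finite sums.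

0≤+ : ∀ {i j} → 0ℤ ≤ i → 0ℤ ≤ j → 0ℤ ≤ i + j
0≤+ = ℤ.+-mono-≤

0≤* : ∀ {i j} → 0ℤ ≤ i → 0ℤ ≤ j → 0ℤ ≤ i * j
0≤* {+ m} {+ n} _ _ = subst (0ℤ ≤_) (ℤ.pos-* m n) (+≤+ N.z≤n)

0≤square : ∀ i → 0ℤ ≤ i * i
0≤square (+ n) = 0≤* {+ n} {+ n} (+≤+ N.z≤n) (+≤+ N.z≤n)
0≤square Z.-[1+ n ] = +≤+ N.z≤n

-- Reduces an inequality to a visibly nonnegative difference `d` and an identity that the ring
-- solver can check.
≤-by : ∀ {i j d} → 0ℤ ≤ d → j ≡ i + d → i ≤ j
≤-by {i} 0≤d j≡i+d = subst₂ _≤_ (ℤ.+-identityʳ i) (sym j≡i+d) (ℤ.+-monoʳ-≤ i 0≤d)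

gap : ∀ {i j} → i ≤ j → 0ℤ ≤ j - i
gap = ℤ.i≤j⇒0≤j-i

module _ {X : Set} where

  ∑ : List X → (X → ℤ) → ℤ
  ∑ []       f = 0ℤ
  ∑ (x ∷ xs) f = f x + ∑ xs f

  ∑-cong : ∀ xs {f g : X → ℤ} → (∀ x → f x ≡ g x) → ∑ xs f ≡ ∑ xs g
  ∑-cong []       eq = refl
  ∑-cong (x ∷ xs) eq = cong₂ _+_ (eq x) (∑-cong xs eq)

  ∑-mono : ∀ xs {f g : X → ℤ} → (∀ x → f x ≤ g x) → ∑ xs f ≤ ∑ xs g
  ∑-mono []       le = ℤ.≤-refl
  ∑-mono (x ∷ xs) le = ℤ.+-mono-≤ (le x) (∑-mono xs le)

  ∑-+ : ∀ xs (f g : X → ℤ) → ∑ xs (λ x → f x + g x) ≡ ∑ xs f + ∑ xs g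
  ∑-+ []       f g = refl
  ∑-+ (x ∷ xs) f g = trans (cong (_+_ (f x + g x)) (∑-+ xs f g)) (interchange (f x) (g x) _ _)
    where
    interchange : ∀ a b c d → a + b + (c + d) ≡ a + c + (b + d)
    interchange = solve-∀

  ∑-* : ∀ xs k (f : X → ℤ) → ∑ xs (λ x → k * f x) ≡ k * ∑ xs f
  ∑-* []       k f = sym (ℤ.*-zeroʳ k)
  ∑-* (x ∷ xs) k f = trans (cong (_+_ (k * f x)) (∑-* xs k f)) (sym (ℤ.*-distribˡ-+ k (f x) _))

  ∑-0 : ∀ xs → ∑ xs (λ _ → 0ℤ) ≡ 0ℤ
  ∑-0 []       = refl
  ∑-0 (x ∷ xs) = trans (ℤ.+-identityˡ _) (∑-0 xs)

  ∑-nonneg : ∀ xs {f : X → ℤ} → (∀ x → 0ℤ ≤ f x) → 0ℤ ≤ ∑ xs f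
  ∑-nonneg xs {f} 0≤f = subst (_≤ ∑ xs f) (∑-0 xs) (∑-mono xs 0≤f)

  ∑-++ : ∀ xs ys (f : X → ℤ) → ∑ (xs List.++ ys) f ≡ ∑ xs f + ∑ ys f
  ∑-++ []       ys f = sym (ℤ.+-identityˡ _)
  ∑-++ (x ∷ xs) ys f = trans (cong (_+_ (f x)) (∑-++ xs ys f)) (sym (ℤ.+-assoc (f x) _ _))

∑-map : ∀ {X Y : Set} (g : X → Y) xs (f : Y → ℤ) → ∑ (List.map g xs) f ≡ ∑ xs (λ x → f (g x))
∑-map g []       f = refl
∑-map g (x ∷ xs) f = cong (_+_ (f (g x))) (∑-map g xs f)

∑-× : ∀ {X Y : Set} (xs : List X) (ys : List Y) (f : X × Y → ℤ) →
      ∑ (cartesianProduct xs ys) f ≡ ∑ xs (λ x → ∑ ys (λ y → f (x , y)))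
∑-× []       ys f = refl
∑-× (x ∷ xs) ys f = trans (∑-++ (List.map (x ,_) ys) _ f) (cong₂ _+_ (∑-map (x ,_) ys f) (∑-× xs ys f))

-- Greedy compression of a vector into a short signed sum.

sgn : Bool → ℤ
sgn true  = 1ℤ
sgn false = -1ℤ

sgn*∣∣ : ∀ i → ∃ λ s → sgn s * i ≡ + ∣ i ∣
sgn*∣∣ (+ n)      = true  , ℤ.*-identityˡ (+ n)
sgn*∣∣ Z.-[1+ n ] = false , ℤ.-1*i≡-i Z.-[1+ n ]

sgn² : ∀ s → sgn s * sgn s ≡ 1ℤ
sgn² true  = refl
sgn² false = refl

-- Perceptron-style compression of a vector: subtracting ± v i from the residual whenever their
-- inner product exceeds V lowers the squared norm by more than V, so it happens at most f times.
module Compression {X : Set} (I : List X) where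

  ⟨_,_⟩ : (X → ℤ) → (X → ℤ) → ℤ
  ⟨ u , v ⟩ = ∑ I (λ x → u x * v x)

  ip-linear : ∀ u k v w → ⟨ (λ x → u x - k * v x) , w ⟩ ≡ ⟨ u , w ⟩ - k * ⟨ v , w ⟩
  ip-linear u k v w = begin
    ∑ I (λ x → (u x - k * v x) * w x)              ≡⟨ ∑-cong I (λ x → expand (u x) k (v x) (w x)) ⟩
    ∑ I (λ x → u x * w x + - k * (v x * w x))      ≡⟨ ∑-+ I _ _ ⟩
    ⟨ u , w ⟩ + ∑ I (λ x → - k * (v x * w x))      ≡⟨ cong (_+_ ⟨ u , w ⟩) (∑-* I (- k) _) ⟩
    ⟨ u , w ⟩ + - k * ⟨ v , w ⟩                    ≡⟨ cong (_+_ ⟨ u , w ⟩) (ℤ.neg-distribˡ-* k _) ⟨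
    ⟨ u , w ⟩ - k * ⟨ v , w ⟩                      ∎
    where
    open ≡-Reasoning
    expand : ∀ a k b c → (a - k * b) * c ≡ a * c + - k * (b * c)
    expand = solve-∀

  ip-scale : ∀ k u w → ⟨ (λ x → k * u x) , w ⟩ ≡ k * ⟨ u , w ⟩
  ip-scale k u w = trans (∑-cong I (λ x → ℤ.*-assoc k (u x) (w x))) (∑-* I k _)

  ip-comm : ∀ u w → ⟨ u , w ⟩ ≡ ⟨ w , u ⟩
  ip-comm u w = ∑-cong I (λ x → ℤ.*-comm (u x) (w x))

  norm-nonneg : ∀ u → 0ℤ ≤ ⟨ u , u ⟩
  norm-nonneg u = ∑-nonneg I (λ x → 0≤square (u x))

  norm-step : ∀ u k v → ⟨ (λ x → u x - k * v x) , (λ x → u x - k * v x) ⟩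
              ≡ ⟨ u , u ⟩ - (k * ⟨ u , v ⟩ + k * ⟨ u , v ⟩) + k * k * ⟨ v , v ⟩
  norm-step u k v = begin
    ⟨ r , r ⟩                                          ≡⟨ ip-linear u k v r ⟩
    ⟨ u , r ⟩ - k * ⟨ v , r ⟩                          ≡⟨ cong₂ (λ a b → a - k * b) (ip-comm u r) (ip-comm v r) ⟩
    ⟨ r , u ⟩ - k * ⟨ r , v ⟩                          ≡⟨ cong₂ (λ a b → a - k * b) (ip-linear u k v u) (ip-linear u k v v) ⟩
    ⟨ u , u ⟩ - k * ⟨ v , u ⟩ - k * (⟨ u , v ⟩ - k * ⟨ v , v ⟩)
      ≡⟨ cong (λ a → ⟨ u , u ⟩ - k * a - k * (⟨ u , v ⟩ - k * ⟨ v , v ⟩)) (ip-comm v u) ⟩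
    ⟨ u , u ⟩ - k * ⟨ u , v ⟩ - k * (⟨ u , v ⟩ - k * ⟨ v , v ⟩)
      ≡⟨ expand ⟨ u , u ⟩ k ⟨ u , v ⟩ ⟨ v , v ⟩ ⟩
    ⟨ u , u ⟩ - (k * ⟨ u , v ⟩ + k * ⟨ u , v ⟩) + k * k * ⟨ v , v ⟩ ∎
    where
    open ≡-Reasoning
    r : X → ℤ
    r x = u x - k * v x
    expand : ∀ a k b c → a - k * b - k * (b - k * c) ≡ a - (k * b + k * b) + k * k * c
    expand = solve-∀

  module _ {K : ℕ} (v : Fin K → X → ℤ) where

    -- The inner product of `w` with a signed sum of vectors `v i`. Only such inner products are
    -- ever read off, so the sum itself is not formed.
    combination : ∀ {f} → Vec (Fin K × Bool) f → (X → ℤ) → ℤ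
    combination []             w = 0ℤ
    combination ((i , s) ∷ st) w = sgn s * ⟨ v i , w ⟩ + combination st w

    module _ (V : ℕ) {Valid : Fin K → Set} (valid? : Decidable Valid)
             (norm≤V : ∀ i → Valid i → ⟨ v i , v i ⟩ ≤ + V)
             -- Unused steps are padded with null, so that f steps are always sent.
             (null : Fin K) (v-null : ∀ w → ⟨ v null , w ⟩ ≡ 0ℤ) where

      combination-null : ∀ f w → combination (replicate f (null , true)) w ≡ 0ℤ
      combination-null zero    w = refl
      combination-null (suc f) w =
        cong₂ _+_ (trans (cong (1ℤ *_) (v-null w)) refl) (combination-null f w)

      -- With `s` the sign of the inner product, the squared norm changes by
      -- `- 2 b + ⟨ v i , v i ⟩`, where `b` is the absolute value of that product; here
      -- `⟨ v i , v i ⟩ ≤ V < b`.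
      norm-drop : ∀ r i s → Valid i → sgn s * ⟨ r , v i ⟩ ≡ + ∣ ⟨ r , v i ⟩ ∣ → V N.< ∣ ⟨ r , v i ⟩ ∣ →
                  ⟨ (λ x → r x - sgn s * v i x) , (λ x → r x - sgn s * v i x) ⟩ < ⟨ r , r ⟩ - + V
      norm-drop r i s ok s-eq big = ℤ.suc[i]≤j⇒i<j (≤-by
        (0≤+ (0≤+ (gap (Z.+≤+ big)) (gap (Z.+≤+ big))) (0≤+ (gap (norm≤V i ok)) (Z.+≤+ (N.z≤n {1}))))
        (begin
          ⟨ r , r ⟩ - + V
            ≡⟨ arith ⟨ r , r ⟩ b (+ V) ⟨ v i , v i ⟩ ⟩
          1ℤ + (⟨ r , r ⟩ - (b + b) + 1ℤ * ⟨ v i , v i ⟩)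
            + ((b - (1ℤ + + V)) + (b - (1ℤ + + V)) + ((+ V - ⟨ v i , v i ⟩) + 1ℤ))
            ≡⟨ cong (λ z → 1ℤ + z + ((b - (1ℤ + + V)) + (b - (1ℤ + + V)) + ((+ V - ⟨ v i , v i ⟩) + 1ℤ))) (sym step) ⟩
          _ ∎))
        where
        open ≡-Reasoning
        b = + ∣ ⟨ r , v i ⟩ ∣
        step : ⟨ (λ x → r x - sgn s * v i x) , (λ x → r x - sgn s * v i x) ⟩
               ≡ ⟨ r , r ⟩ - (b + b) + 1ℤ * ⟨ v i , v i ⟩
        step = trans (norm-step r (sgn s) (v i))
                     (cong₂ (λ a c → ⟨ r , r ⟩ - (a + a) + c * ⟨ v i , v i ⟩) s-eq (sgn² s))
        arith : ∀ n b V w → n - V ≡ 1ℤ + (n - (b + b) + 1ℤ * w) + ((b - (1ℤ + V)) + (b - (1ℤ + V)) + ((V - w) + 1ℤ))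
        arith = solve-∀

      compress : ∀ f r → ⟨ r , r ⟩ ≤ + f * + V →
                 ∃ λ (st : Vec (Fin K × Bool) f) →
                   ∀ i → Valid i → ∣ ⟨ r , v i ⟩ - combination st (v i) ∣ N.≤ V
      compress f r r≤ with Fin.any? (λ i → valid? i ×-dec (V N.<? ∣ ⟨ r , v i ⟩ ∣))
      -- Every valid inner product of the residual is already at most `V`, so the padding, whose
      -- combination is 0, suffices.
      ... | no none = replicate f (null , true) , λ i ok →
            subst (λ z → ∣ ⟨ r , v i ⟩ - z ∣ N.≤ V) (sym (combination-null f (v i)))
              (subst (λ z → ∣ z ∣ N.≤ V) (sym (ℤ.+-identityʳ ⟨ r , v i ⟩))
                (ℕ.≮⇒≥ (λ big → none (i , ok , big))))
      ... | yes (i , ok , big) with sgn*∣∣ ⟨ r , v i ⟩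
      -- With no steps left the squared norm is at most 0, and one more drop would make it negative.
      compress zero r r≤ | yes (i , ok , big) | s , s-eq =
        ⊥-elim (ℤ.<-irrefl refl (ℤ.<-≤-trans (ℤ.≤-<-trans (norm-nonneg (λ x → r x - sgn s * v i x)) (norm-drop r i s ok s-eq big))
          (ℤ.i≤j⇒i-j≤0 (ℤ.≤-trans r≤ (subst (_≤ + V) (sym (ℤ.*-zeroˡ (+ V))) (Z.+≤+ N.z≤n))))))
      compress (suc f) r r≤ | yes (i , ok , big) | s , s-eq =
        let r′ = λ x → r x - sgn s * v i x
            r′≤ = ℤ.≤-trans (ℤ.<⇒≤ (norm-drop r i s ok s-eq big))
                    (subst (⟨ r , r ⟩ - + V ≤_) (shrink (+ f) (+ V)) (ℤ.+-monoˡ-≤ (- + V) r≤))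
            st , close = compress f r′ r′≤
        in (i , s) ∷ st , λ j okj → subst (λ z → ∣ z ∣ N.≤ V)
             (trans (cong (_- combination st (v j)) (ip-linear r (sgn s) (v i) (v j)))
                    (assoc ⟨ r , v j ⟩ (sgn s * ⟨ v i , v j ⟩) (combination st (v j))))
             (close j okj)
        where
        shrink : ∀ f V → (1ℤ + f) * V - V ≡ f * V
        shrink = solve-∀
        assoc : ∀ a b c → a - b - c ≡ a - (b + c)
        assoc = solve-∀

-- First witnesses, and threshold descriptions of decreasing sequences.

least : ∀ {Q : ℕ → Set} → Decidable Q → ∀ n → Q n →
        ∃ λ (a : Fin (suc n)) → Q (toℕ a) × (∀ i → Q i → toℕ a N.≤ i)
least Q? n       Qn with Q? 0
least Q? n       Qn | yes Q0 = zero , Q0 , λ _ _ → N.z≤n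
least Q? zero    Qn | no ¬Q0 = ⊥-elim (¬Q0 Qn)
least Q? (suc n) Qn | no ¬Q0 with least (λ i → Q? (suc i)) n Qn
... | a , Qa , a≤ = suc a , Qa , λ { zero Q0 → ⊥-elim (¬Q0 Q0) ; (suc i) Qi → N.s≤s (a≤ i Qi) }

module _ {Q : ℕ → Set} (Q? : Decidable Q) (Q-pred : ∀ i → Q (suc i) → Q i) where

  downward : ∀ {i j} → i N.≤′ j → Q j → Q i
  downward (N.≤′-reflexive refl) Qj = Qj
  downward (N.≤′-step i≤j)       Qj = downward i≤j (Q-pred _ Qj)

  -- A downward closed set of naturals that misses `n` is an initial segment; `b` is its length.
  threshold : ∀ n → ¬ Q n → ∃ λ (b : Fin (suc n)) → ∀ i → (Q i → i N.< toℕ b) × (i N.< toℕ b → Q i)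
  threshold zero    ¬Q0 = zero , λ i → (λ Qi → ⊥-elim (¬Q0 (downward (ℕ.≤⇒≤′ N.z≤n) Qi))) , λ ()
  threshold (suc n) ¬Qn with Q? n
  ... | no ¬Qn′ with threshold n ¬Qn′
  ...   | b , spec = inject₁ b , λ i → subst (λ z → (Q i → i N.< z) × (i N.< z → Q i)) (sym (Fin.toℕ-inject₁ b)) (spec i)
  threshold (suc n) ¬Qn | yes Qn = fromℕ (suc n) , λ i →
    (λ Qi → subst (i N.<_) (sym (Fin.toℕ-fromℕ (suc n))) (ℕ.≰⇒> λ n<i → ¬Qn (downward (ℕ.≤⇒≤′ n<i) Qi))) ,
    (λ i<b → downward (ℕ.≤⇒≤′ (N.s≤s⁻¹ (subst (i N.<_) (Fin.toℕ-fromℕ (suc n)) i<b))) Qn)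

above : ∀ {n f} → Vec (Fin n) f → ℕ → ℕ
above []       i = 0
above (b ∷ bs) i with i N.<? toℕ b
... | yes _ = suc (above bs i)
... | no  _ = above bs i

above≤ : ∀ {n f} (bs : Vec (Fin n) f) i → above bs i N.≤ f
above≤ []       i = N.z≤n
above≤ (b ∷ bs) i with i N.<? toℕ b
... | yes _ = N.s≤s (above≤ bs i)
... | no  _ = ℕ.m≤n⇒m≤1+n (above≤ bs i)

-- The thresholds mark where `x` falls to `0`, `k`, `2 k`, ..., so the number of them above `i` is
-- `x i / k` rounded up (for positive `k`). The induction splits off the top threshold and truncates
-- `x` at `f * k`, which keeps the lower ones.
staircase : ∀ n k f (x : ℕ → ℕ) → (∀ i → x (suc i) N.≤ x i) → x n ≡ 0 → (∀ i → x i N.≤ f N.* k) →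
            ∃ λ (bs : Vec (Fin (suc n)) f) → ∀ i →
              (x i N.≤ above bs i N.* k) × (above bs i N.* k N.≤ x i N.+ k)
staircase n k zero    x anti x-n x≤ = [] , λ i → x≤ i , N.z≤n
staircase n k (suc f) x anti x-n x≤
  with threshold (λ i → f N.* k N.<? x i) (λ i lt → ℕ.<-≤-trans lt (anti i)) n
         (λ lt → ℕ.n≮0 (subst (f N.* k N.<_) x-n lt))
     | staircase n k f (λ i → x i N.⊓ (f N.* k)) (λ i → ℕ.⊓-monoˡ-≤ (f N.* k) (anti i))
         (cong (N._⊓ (f N.* k)) x-n) (λ i → ℕ.m⊓n≤n (x i) (f N.* k))
... | b , b-spec | bs , bs-spec = b ∷ bs , spec
  where
  spec : ∀ i → (x i N.≤ above (b ∷ bs) i N.* k) × (above (b ∷ bs) i N.* k N.≤ x i N.+ k)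
  spec i with i N.<? toℕ b
  ... | yes i<b =
        ℕ.≤-trans (x≤ i) (ℕ.+-monoʳ-≤ k (subst (N._≤ above bs i N.* k) (ℕ.m≥n⇒m⊓n≡n (ℕ.<⇒≤ fk<x)) (proj₁ (bs-spec i)))) ,
        subst (k N.+ above bs i N.* k N.≤_) (ℕ.+-comm k (x i))
          (ℕ.+-monoʳ-≤ k (ℕ.≤-trans (ℕ.*-monoˡ-≤ k (above≤ bs i)) (ℕ.<⇒≤ fk<x)))
    where fk<x = proj₂ (b-spec i) i<b
  ... | no i≮b = subst (λ z → (z N.≤ above bs i N.* k) × (above bs i N.* k N.≤ z N.+ k))
                   (ℕ.m≤n⇒m⊓n≡m (ℕ.≮⇒≥ λ lt → i≮b (proj₁ (b-spec i) lt))) (bs-spec i)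

-- Fixed-length binary codes.

record Code (M : Set) (L : ℕ) : Set where
  field
    encode        : M → Vec Bool L
    decode        : Vec Bool L → M
    decode-encode : ∀ m → decode (encode m) ≡ m
open Code

take-++ : ∀ {A : Set} {m n} (xs : Vec A m) (ys : Vec A n) → take m (xs ++ ys) ≡ xs
take-++ []       ys = refl
take-++ (x ∷ xs) ys = cong (x ∷_) (take-++ xs ys)

drop-++ : ∀ {A : Set} {m n} (xs : Vec A m) (ys : Vec A n) → drop m (xs ++ ys) ≡ ys
drop-++ []       ys = refl
drop-++ (x ∷ xs) ys = drop-++ xs ys

bool-code : Code Bool 1
bool-code = record
  { encode        = λ b → b ∷ []
  ; decode        = λ { (b ∷ []) → b }
  ; decode-encode = λ _ → refl
  }

infixr 4 _×-code_
_×-code_ : ∀ {M M′ L L′} → Code M L → Code M′ L′ → Code (M × M′) (L N.+ L′)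
_×-code_ {L = L} c c′ = record
  { encode        = λ { (m , m′) → encode c m ++ encode c′ m′ }
  ; decode        = λ bs → decode c (take L bs) , decode c′ (drop L bs)
  ; decode-encode = λ { (m , m′) → cong₂ _,_
      (trans (cong (decode c) (take-++ (encode c m) _)) (decode-encode c m))
      (trans (cong (decode c′) (drop-++ (encode c m) _)) (decode-encode c′ m′)) }
  }

vec-code : ∀ {M L} f → Code M L → Code (Vec M f) (f N.* L)
vec-code zero c = record { encode = λ _ → [] ; decode = λ _ → [] ; decode-encode = λ { [] → refl } }
vec-code (suc f) c = record
  { encode        = λ { (m ∷ ms) → encode p (m , ms) }
  ; decode        = λ bs → proj₁ (decode p bs) ∷ proj₂ (decode p bs)
  ; decode-encode = λ { (m ∷ ms) → cong (λ q → proj₁ q ∷ proj₂ q) (decode-encode p (m , ms)) }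
  }
  where p = c ×-code vec-code f c

bits-code : ∀ b → Code (Fin (2 N.^ b)) b
bits-code zero    = record { encode = λ _ → [] ; decode = λ _ → zero ; decode-encode = λ { zero → refl } }
bits-code (suc b) = record
  -- The quotient by `2 ^ b` is the leading bit, the remainder gives the others.
  { encode        = λ i → bit (proj₁ (remQuot {2} (2 N.^ b) i)) ∷ encode c (proj₂ (remQuot {2} (2 N.^ b) i))
  ; decode        = λ { (x ∷ xs) → combine (unbit x) (decode c xs) }
  ; decode-encode = λ i → trans
      (cong₂ combine (unbit-bit (proj₁ (remQuot {2} (2 N.^ b) i))) (decode-encode c (proj₂ (remQuot {2} (2 N.^ b) i))))
      (Fin.combine-remQuot {2} (2 N.^ b) i)
  }
  where
  c = bits-code b
  bit : Fin 2 → Bool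
  bit zero    = false
  bit (suc _) = true
  unbit : Bool → Fin 2
  unbit false = zero
  unbit true  = suc zero
  unbit-bit : ∀ i → unbit (bit i) ≡ i
  unbit-bit zero       = refl
  unbit-bit (suc zero) = refl

fin-code : ∀ {n b} → suc n N.≤ 2 N.^ b → Code (Fin (suc n)) b
fin-code {n} {b} n<2^b = record
  { encode        = λ i → encode (bits-code b) (inject≤ i n<2^b)
  ; decode        = λ bs → clamp (toℕ (decode (bits-code b) bs))
  ; decode-encode = λ i → trans
      (cong clamp (trans (cong toℕ (decode-encode (bits-code b) (inject≤ i n<2^b))) (Fin.toℕ-inject≤ i n<2^b)))
      (clamp-toℕ i)
  }
  where
  clamp : ℕ → Fin (suc n)
  clamp m with m N.<? suc n
  ... | yes m<n = fromℕ< m<n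
  -- An arbitrary default for bit strings whose value exceeds `n`; no codeword has such a value.
  ... | no  _   = zero
  clamp-toℕ : ∀ i → clamp (toℕ i) ≡ i
  clamp-toℕ i with toℕ i N.<? suc n
  ... | yes i<n = Fin.fromℕ<-toℕ i i<n
  ... | no  i≮n = ⊥-elim (i≮n (Fin.toℕ<n i))

-- Powers of two and the scales.

n≤2*⌈n/2⌉ : ∀ n → n N.≤ 2 N.* N.⌈ n /2⌉
n≤2*⌈n/2⌉ n = begin
  n                              ≡⟨ ℕ.⌊n/2⌋+⌈n/2⌉≡n n ⟨
  N.⌊ n /2⌋ N.+ N.⌈ n /2⌉        ≤⟨ ℕ.+-mono-≤ (ℕ.⌊n/2⌋≤⌈n/2⌉ n) (ℕ.m≤m+n _ 0) ⟩
  2 N.* N.⌈ n /2⌉                ∎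
  where open ℕ.≤-Reasoning

n≤2^⌈log₂n⌉ : ∀ n → n N.≤ 2 N.^ ⌈log₂ n ⌉
n≤2^⌈log₂n⌉ = <-rec _ go
  where
  open ℕ.≤-Reasoning
  go : ∀ n → (∀ {m} → m N.< n → m N.≤ 2 N.^ ⌈log₂ m ⌉) → n N.≤ 2 N.^ ⌈log₂ n ⌉
  go 0             rec = N.z≤n
  go 1             rec = ℕ.≤-refl
  go n@(suc (suc m)) rec = begin
    n                                       ≤⟨ n≤2*⌈n/2⌉ n ⟩
    2 N.* N.⌈ n /2⌉                         ≤⟨ ℕ.*-monoʳ-≤ 2 (rec (ℕ.⌈n/2⌉<n m)) ⟩
    2 N.^ suc ⌈log₂ N.⌈ n /2⌉ ⌉             ≡⟨ cong (λ z → 2 N.^ suc z) (⌈log₂⌈n/2⌉⌉≡⌈log₂n⌉∸1 n) ⟩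
    2 N.^ suc (⌈log₂ n ⌉ N.∸ 1)             ≡⟨ cong (2 N.^_) (ℕ.m+[n∸m]≡n (⌈log₂⌉-mono-≤ {2} {n} (N.s≤s (N.s≤s N.z≤n)))) ⟩
    2 N.^ ⌈log₂ n ⌉                         ∎

-- Scale 0 is included because at distance 0 a multiplicative approximation must be exact.
level : ℕ → ℕ
level zero    = 0
level (suc j) = 2 N.^ j

-- The first power of two that reaches a positive `h` overshoots by at most a factor of two, as the
-- preceding power lies below `h`.
level-for : ∀ b h → h N.≤ 2 N.^ b → ∃ λ (j : Fin (suc (suc b))) → h N.≤ level (toℕ j) × level (toℕ j) N.≤ 2 N.* h
level-for b       zero    _  = zero , N.z≤n , N.z≤n
level-for zero    (suc h) h≤ = suc zero , h≤ , N.s≤s N.z≤n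
level-for (suc b) (suc h) h≤ with suc h N.≤? 2 N.^ b
... | no h≰ = fromℕ (suc (suc b)) , subst (λ z → suc h N.≤ level z × level z N.≤ 2 N.* suc h)
                (sym (Fin.toℕ-fromℕ (suc (suc b)))) (h≤ , ℕ.*-monoʳ-≤ 2 (ℕ.<⇒≤ (ℕ.≰⇒> h≰)))
... | yes h≤′ with level-for b (suc h) h≤′
...   | j , spec = inject₁ j , subst (λ z → suc h N.≤ level z × level z N.≤ 2 N.* suc h) (sym (Fin.toℕ-inject₁ j)) spec

-- Sums over text positions and indicators of suffixes.

∑-upTo-suc : ∀ n (f : ℕ → ℤ) → ∑ (upTo (suc n)) f ≡ f 0 + ∑ (upTo n) (λ q → f (suc q))
∑-upTo-suc n f = cong (_+_ (f 0)) (trans (cong (λ qs → ∑ qs f) (sym (List.map-upTo suc n))) (∑-map suc (upTo n) f))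

-- The indicator of `i ≤ q`: it selects the positions of the first half that the pattern placed at
-- `i` covers.
χ : ℕ → ℕ → ℤ
χ zero    q       = 1ℤ
χ (suc i) zero    = 0ℤ
χ (suc i) (suc q) = χ i q

0≤χ : ∀ i q → 0ℤ ≤ χ i q
0≤χ zero    q       = +≤+ N.z≤n
0≤χ (suc i) zero    = +≤+ N.z≤n
0≤χ (suc i) (suc q) = 0≤χ i q

χ-absorb : ∀ {a i} q → a N.≤ i → χ a q * χ i q ≡ χ i q
χ-absorb {zero}          q       a≤i           = ℤ.*-identityˡ _
χ-absorb {suc a} {suc i} zero    a≤i           = refl
χ-absorb {suc a} {suc i} (suc q) (N.s≤s a≤i)   = χ-absorb q a≤i

χ-anti : ∀ {a i} q → a N.≤ i → χ i q ≤ χ a q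
χ-anti {zero}  {zero}  q       a≤i         = ℤ.≤-refl
χ-anti {zero}  {suc i} zero    a≤i         = +≤+ N.z≤n
χ-anti {zero}  {suc i} (suc q) a≤i         = χ-anti {zero} {i} q N.z≤n
χ-anti {suc a} {suc i} zero    a≤i         = ℤ.≤-refl
χ-anti {suc a} {suc i} (suc q) (N.s≤s a≤i) = χ-anti q a≤i

∑-χ-beyond : ∀ n (f : ℕ → ℤ) → ∑ (upTo n) (λ q → χ n q * f q) ≡ 0ℤ
∑-χ-beyond zero    f = refl
∑-χ-beyond (suc n) f =
  trans (∑-upTo-suc n (λ q → χ (suc n) q * f q)) (cong₂ _+_ (ℤ.*-zeroˡ (f 0)) (∑-χ-beyond n (λ q → f (suc q))))

∑-upTo-1 : ∀ n → ∑ (upTo n) (λ _ → 1ℤ) ≡ + n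
∑-upTo-1 zero    = refl
∑-upTo-1 (suc n) = trans (∑-upTo-suc n (λ _ → 1ℤ)) (cong (_+_ 1ℤ) (∑-upTo-1 n))

-- Mismatch counts as inner products of 0/1 vectors.

module Indicator {A : Set} (_≟_ : DecidableEquality A) where

  δ : A → A → ℤ
  δ x y with x ≟ y
  ... | yes _ = 1ℤ
  ... | no  _ = 0ℤ

  δ-refl : ∀ x → δ x x ≡ 1ℤ
  δ-refl x with x ≟ x
  ... | yes _ = refl
  ... | no ¬p = ⊥-elim (¬p refl)

  δ-≢ : ∀ {x y} → x ≢ y → δ x y ≡ 0ℤ
  δ-≢ {x} {y} x≢y with x ≟ y
  ... | yes x≡y = ⊥-elim (x≢y x≡y)
  ... | no _    = refl

  mis : A → A → ℤ
  mis x y = 1ℤ - δ x y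

  0≤mis : ∀ x y → 0ℤ ≤ mis x y
  0≤mis x y with x ≟ y
  ... | yes _ = +≤+ N.z≤n
  ... | no  _ = +≤+ N.z≤n

  mis≤1 : ∀ x y → mis x y ≤ 1ℤ
  mis≤1 x y with x ≟ y
  ... | yes _ = +≤+ N.z≤n
  ... | no  _ = ℤ.≤-refl

  mis-triangle : ∀ x y z → mis x y ≤ mis z y + mis z x
  mis-triangle x y z with x ≟ y | z ≟ y | z ≟ x
  ... | yes _   | yes _    | yes _    = +≤+ N.z≤n
  ... | yes _   | yes _    | no  _    = +≤+ N.z≤n
  ... | yes _   | no  _    | yes _    = +≤+ N.z≤n
  ... | yes _   | no  _    | no  _    = +≤+ N.z≤n
  ... | no  x≢y | yes refl | yes refl = ⊥-elim (x≢y refl)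
  ... | no  _   | yes _    | no  _    = +≤+ (N.s≤s N.z≤n)
  ... | no  _   | no  _    | yes _    = +≤+ (N.s≤s N.z≤n)
  ... | no  _   | no  _    | no  _    = +≤+ (N.s≤s N.z≤n)

  sift-∉ : ∀ {x S} (f : A → ℤ) → All (x ≢_) S → ∑ S (λ c → δ x c * f c) ≡ 0ℤ
  sift-∉ f []          = refl
  sift-∉ {x} {c ∷ S} f (x≢c ∷ x≢S) = cong₂ _+_ (cong (_* f c) (δ-≢ x≢c)) (sift-∉ f x≢S)

  -- On a list without repetitions `δ x` has a single nonzero entry, so summing against it evaluates
  -- `f` at `x`.
  sift : ∀ {x S} (f : A → ℤ) → Unique S → x ∈ S → ∑ S (λ c → δ x c * f c) ≡ f x
  sift {x} {c ∷ S} f (c≢S ∷ _) (here refl) =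
    trans (cong₂ _+_ (trans (cong (_* f x) (δ-refl x)) (ℤ.*-identityˡ (f x))) (sift-∉ f c≢S)) (ℤ.+-identityʳ (f x))
  sift {x} {c ∷ S} f (c≢S ∷ uniq) (there x∈S) =
    trans (cong₂ _+_ (cong (_* f c) (δ-≢ (λ x≡c → All.lookup c≢S x∈S (sym x≡c)))) (sift f uniq x∈S)) (ℤ.+-identityˡ (f x))

  -- The sum is 1 or 0: a text symbol that does not occur in the pattern is encoded by the zero
  -- vector.
  ∑δ²≤1 : ∀ x {S} → Unique S → ∑ S (λ c → δ x c * δ x c) ≤ 1ℤ
  ∑δ²≤1 x {[]}    _ = +≤+ N.z≤n
  ∑δ²≤1 x {c ∷ S} (c≢S ∷ uniq) with x ≟ c
  ... | yes refl = ℤ.≤-reflexive (cong (_+_ 1ℤ) (sift-∉ (δ x) c≢S))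
  ... | no _     = subst (_≤ 1ℤ) (sym (ℤ.+-identityˡ _)) (∑δ²≤1 x uniq)

  -- The alphabet may be infinite, so coordinates range over a finite list `S`, later the symbols of
  -- the pattern, which both players know.
  module Geometry (n : ℕ) (S : List A) (uniq : Unique S) where

    open Compression (cartesianProduct (upTo n) S) public

    mismatches : ℕ → (ℕ → A) → (ℕ → A) → ℤ
    mismatches i x y = ∑ (upTo n) (λ q → χ i q * mis (x q) (y q))

    0≤mismatches : ∀ i x y → 0ℤ ≤ mismatches i x y
    0≤mismatches i x y = ∑-nonneg (upTo n) (λ q → 0≤* (0≤χ i q) (0≤mis (x q) (y q)))

    mismatches-anti : ∀ {a i} x y → a N.≤ i → mismatches i x y ≤ mismatches a x y
    mismatches-anti {a} {i} x y a≤i = ∑-mono (upTo n) λ q → ≤-by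
      (0≤* (gap (χ-anti q a≤i)) (0≤mis (x q) (y q))) (arith (χ a q) (χ i q) (mis (x q) (y q)))
      where
      arith : ∀ a i m → a * m ≡ i * m + (a - i) * m
      arith = solve-∀

    mismatches≤n : ∀ i x y → mismatches i x y ≤ + n
    mismatches≤n i x y = subst (mismatches i x y ≤_) (∑-upTo-1 n) (ℤ.≤-trans (mismatches-anti {0} {i} x y N.z≤n)
      (∑-mono (upTo n) (λ q → subst (_≤ 1ℤ) (sym (ℤ.*-identityˡ (mis (x q) (y q)))) (mis≤1 (x q) (y q)))))

    mismatches-n : ∀ x y → mismatches n x y ≡ 0ℤ
    mismatches-n x y = ∑-χ-beyond n _

    mismatches-triangle : ∀ i x y z → mismatches i x y ≤ mismatches i z y + mismatches i z x
    mismatches-triangle i x y z = subst (mismatches i x y ≤_) (∑-+ (upTo n) _ _)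
      (∑-mono (upTo n) λ q → ≤-by (0≤* (0≤χ i q) (gap (mis-triangle (x q) (y q) (z q))))
        (arith (χ i q) (mis (x q) (y q)) (mis (z q) (y q)) (mis (z q) (x q))))
      where
      arith : ∀ k a b c → k * b + k * c ≡ k * a + k * (b + c - a)
      arith = solve-∀

    -- The difference of the 0/1 encodings of `x` and `y`, restricted to positions from `i` on.
    diff : ℕ → (ℕ → A) → (ℕ → A) → ℕ × A → ℤ
    diff i x y (q , c) = χ i q * (δ (x q) c - δ (y q) c)

    diff-n-null : ∀ x y w → ⟨ diff n x y , w ⟩ ≡ 0ℤ
    diff-n-null x y w = begin
      ⟨ diff n x y , w ⟩
        ≡⟨ ∑-× (upTo n) S _ ⟩
      ∑ (upTo n) (λ q → ∑ S (λ c → χ n q * (δ (x q) c - δ (y q) c) * w (q , c)))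
        ≡⟨ ∑-cong (upTo n) (λ q → trans (∑-cong S (λ c → ℤ.*-assoc (χ n q) _ _)) (∑-* S (χ n q) _)) ⟩
      ∑ (upTo n) (λ q → χ n q * ∑ S (λ c → (δ (x q) c - δ (y q) c) * w (q , c)))
        ≡⟨ ∑-χ-beyond n _ ⟩
      0ℤ ∎
      where open ≡-Reasoning

    -- A selected position contributes `1 - 2 δ (y q) (x q)` plus the squared norm of the symbol
    -- `y q`. That norm is at most 1, which leaves at most twice the mismatch indicator.
    norm-diff : ∀ i x y → (∀ q → x q ∈ S) → ⟨ diff i x y , diff i x y ⟩ ≤ + 2 * mismatches i y x
    norm-diff i x y x∈S = subst₂ _≤_ (sym (∑-× (upTo n) S _)) (∑-* (upTo n) (+ 2) _) (∑-mono (upTo n) at)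
      where
      square : ∀ k a b → k * (a - b) * (k * (a - b)) ≡ k * k * (a * (a - (b + b)) + b * b)
      square = solve-∀
      sum : ∀ q → ∑ S (λ c → diff i x y (q , c) * diff i x y (q , c))
              ≡ χ i q * (1ℤ - (δ (y q) (x q) + δ (y q) (x q)) + ∑ S (λ c → δ (y q) c * δ (y q) c))
      sum q = begin
        ∑ S (λ c → diff i x y (q , c) * diff i x y (q , c))
          ≡⟨ ∑-cong S (λ c → trans (square (χ i q) (δ (x q) c) (δ (y q) c)) (cong (_* (δ (x q) c * (δ (x q) c - (δ (y q) c + δ (y q) c)) + δ (y q) c * δ (y q) c)) (χ-absorb {i} {i} q ℕ.≤-refl))) ⟩
        ∑ S (λ c → χ i q * (δ (x q) c * (δ (x q) c - (δ (y q) c + δ (y q) c)) + δ (y q) c * δ (y q) c))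
          ≡⟨ ∑-* S (χ i q) _ ⟩
        χ i q * ∑ S (λ c → δ (x q) c * (δ (x q) c - (δ (y q) c + δ (y q) c)) + δ (y q) c * δ (y q) c)
          ≡⟨ cong (χ i q *_) (∑-+ S _ _) ⟩
        χ i q * (∑ S (λ c → δ (x q) c * (δ (x q) c - (δ (y q) c + δ (y q) c))) + ∑ S (λ c → δ (y q) c * δ (y q) c))
          ≡⟨ cong (λ z → χ i q * (z + ∑ S (λ c → δ (y q) c * δ (y q) c)))
               (trans (sift (λ c → δ (x q) c - (δ (y q) c + δ (y q) c)) uniq (x∈S q))
                      (cong (_- (δ (y q) (x q) + δ (y q) (x q))) (δ-refl (x q)))) ⟩
        χ i q * (1ℤ - (δ (y q) (x q) + δ (y q) (x q)) + ∑ S (λ c → δ (y q) c * δ (y q) c)) ∎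
        where open ≡-Reasoning
      arith : ∀ k d s → + 2 * (k * (1ℤ - d)) ≡ k * (1ℤ - (d + d) + s) + k * (1ℤ - s)
      arith = solve-∀
      at : ∀ q → ∑ S (λ c → diff i x y (q , c) * diff i x y (q , c)) ≤ + 2 * (χ i q * mis (y q) (x q))
      at q = subst (_≤ + 2 * (χ i q * mis (y q) (x q))) (sym (sum q))
        (≤-by (0≤* (0≤χ i q) (gap (∑δ²≤1 (y q) uniq))) (arith (χ i q) (δ (y q) (x q)) _))

    -- At a position `q` from `i` on, the two differences have inner product
    -- `mis t y - mis t z - mis z y`, all taken at `q`. Sifting happens at the symbols of `y` and
    -- `z`, so the text `t` may contain symbols outside `S`. As `a ≤ i`, the mask of the second
    -- vector absorbs that of the first.
    ip-diff : ∀ {a i} t y z → a N.≤ i → (∀ q → y q ∈ S) → (∀ q → z q ∈ S) →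
              mismatches i t y ≡ mismatches i t z + mismatches i z y + ⟨ diff a z t , diff i y z ⟩
    ip-diff {a} {i} t y z a≤i y∈S z∈S = sym (begin
      mismatches i t z + mismatches i z y + ⟨ diff a z t , diff i y z ⟩
        ≡⟨ cong (_+_ (mismatches i t z + mismatches i z y)) (trans (∑-× (upTo n) S _) (∑-cong (upTo n) at)) ⟩
      mismatches i t z + mismatches i z y + ∑ (upTo n) (λ q → χ i q * D q)
        ≡⟨ cong (_+ ∑ (upTo n) (λ q → χ i q * D q)) (∑-+ (upTo n) _ _) ⟨
      ∑ (upTo n) (λ q → χ i q * mis (t q) (z q) + χ i q * mis (z q) (y q)) + ∑ (upTo n) (λ q → χ i q * D q)
        ≡⟨ ∑-+ (upTo n) _ _ ⟨
      ∑ (upTo n) (λ q → χ i q * mis (t q) (z q) + χ i q * mis (z q) (y q) + χ i q * D q)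
        ≡⟨ ∑-cong (upTo n) (λ q → collect (χ i q) (δ (t q) (z q)) (δ (z q) (y q)) (δ (t q) (y q))) ⟩
      mismatches i t y ∎)
      where
      open ≡-Reasoning
      D : ℕ → ℤ
      D q = (δ (z q) (y q) - δ (t q) (y q)) - (1ℤ - δ (t q) (z q))
      collect : ∀ k tz zy ty → k * (1ℤ - tz) + k * (1ℤ - zy) + k * ((zy - ty) - (1ℤ - tz)) ≡ k * (1ℤ - ty)
      collect = solve-∀
      expand : ∀ k l z t y → k * (z - t) * (l * (y - z)) ≡ k * l * (y * (z - t) + -1ℤ * (z * (z - t)))
      expand = solve-∀
      at : ∀ q → ∑ S (λ c → diff a z t (q , c) * diff i y z (q , c)) ≡ χ i q * D q
      at q = begin
        ∑ S (λ c → diff a z t (q , c) * diff i y z (q , c))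
          ≡⟨ ∑-cong S (λ c → trans (expand (χ a q) (χ i q) (δ (z q) c) (δ (t q) c) (δ (y q) c)) (cong (_* (δ (y q) c * f c + -1ℤ * (δ (z q) c * f c))) (χ-absorb q a≤i))) ⟩
        ∑ S (λ c → χ i q * (δ (y q) c * f c + -1ℤ * (δ (z q) c * f c)))
          ≡⟨ ∑-* S (χ i q) _ ⟩
        χ i q * ∑ S (λ c → δ (y q) c * f c + -1ℤ * (δ (z q) c * f c))
          ≡⟨ cong (χ i q *_) (trans (∑-+ S _ _) (cong₂ _+_ (sift f uniq (y∈S q)) (trans (∑-* S -1ℤ _) (cong (-1ℤ *_) (sift f uniq (z∈S q)))))) ⟩
        χ i q * (f (y q) + -1ℤ * f (z q))
          ≡⟨ cong (λ w → χ i q * (f (y q) + -1ℤ * (w - δ (t q) (z q)))) (δ-refl (z q)) ⟩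
        χ i q * (f (y q) + -1ℤ * (1ℤ - δ (t q) (z q)))
          ≡⟨ cong (λ w → χ i q * (f (y q) + w)) (ℤ.-1*i≡-i _) ⟩
        χ i q * D q ∎
        where
        f : A → ℤ
        f c = δ (z q) c - δ (t q) c

-- The sketch for a single scale.

∣∣≤⇒≤ : ∀ i {m} → ∣ i ∣ N.≤ m → i ≤ + m
∣∣≤⇒≤ (+ n)      le = +≤+ le
∣∣≤⇒≤ Z.-[1+ n ] le = Z.-≤+

∣∣≤⇒0≤+ : ∀ i {m} → ∣ i ∣ N.≤ m → 0ℤ ≤ + m + i
∣∣≤⇒0≤+ (+ n)      le = +≤+ N.z≤n
∣∣≤⇒0≤+ Z.-[1+ n ] le = gap (+≤+ le)

-- The first alignment within the scale, the thresholds of the monotone term, and the signed indices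
-- of the vectors whose sum approximates N u.
Sketch : ℕ → ℕ → Set
Sketch n N = Fin (suc n) × Vec (Fin (suc n)) N × Vec (Fin (suc n) × Bool) (N N.* N)

-- Everything is multiplied by `N` to stay within the integers. The error `9 k` is made up of `k`
-- for the staircase, `4 k` for the compression and `4 k` for the shift that turns the estimate into
-- an upper bound.
Faithful : ℕ → ℕ → ℤ → ℤ → Set
Faithful N k d e = + N * d ≤ e × (d ≤ + k → e ≤ + N * d + + 9 * + k)

module LevelSketch {A : Set} (_≟_ : DecidableEquality A) (n : ℕ) (S : List A) (uniq : Unique S)
                   (p : ℕ → A) (p∈S : ∀ j → p j ∈ S) where

  open Indicator _≟_
  open Geometry n S uniq

  -- Left of `i` the truncated subtraction gives `p 0`; the mask in `distance` hides these
  -- positions.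
  place : ℕ → ℕ → A
  place i q = p (q N.∸ i)

  place∈S : ∀ i q → place i q ∈ S
  place∈S i q = p∈S (q N.∸ i)

  distance : (ℕ → A) → ℕ → ℤ
  distance t i = mismatches i t (place i)

  -- Given `a`, these vectors depend on the pattern alone, so Bob can form them himself.
  offset : ℕ → Fin (suc n) → ℕ × A → ℤ
  offset a i = diff (toℕ i) (place (toℕ i)) (place a)

  -- Bob's substitute for the condition `distance t i ≤ k`, which he cannot test. It follows from
  -- that condition when `a` is the first alignment within the scale, and it still bounds the
  -- squared norm of the offset by `4 k`.
  Near : ℕ → ℕ → Fin (suc n) → Set
  Near k a i = a N.≤ toℕ i × mismatches (toℕ i) (place a) (place (toℕ i)) ≤ + 2 * + k

  near? : ∀ k a i → Dec (Near k a i)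
  near? k a i = (a N.≤? toℕ i) ×-dec (mismatches (toℕ i) (place a) (place (toℕ i)) ℤ.≤? + 2 * + k)

  -- The decision is an argument so that proofs can match on it. The final summand `4 k` outweighs
  -- the compression error and so keeps the estimate an upper bound.
  estimate-if : ∀ {N} k (sk : Sketch n N) i → Dec (Near k (toℕ (proj₁ sk)) i) → ℤ
  estimate-if {N} k (a , bs , st) i (yes _) =
    + (above bs (toℕ i)) * + k + + N * mismatches (toℕ i) (place (toℕ a)) (place (toℕ i))
    + combination (offset (toℕ a)) st (offset (toℕ a) i) + + (4 N.* k)
  -- No distance exceeds `n`, so this default is still an upper bound and does no harm to a minimum
  -- over scales.
  estimate-if {N} k sk i (no _) = + N * + n

  estimate : ∀ {N} → ℕ → Sketch n N → Fin (suc n) → ℤ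
  estimate k sk i = estimate-if k sk i (near? k (toℕ (proj₁ sk)) i)

  module _ (N k : ℕ) (t : ℕ → A) (a : Fin (suc n)) (dist-a : distance t (toℕ a) ≤ + k) where

    private
      α = toℕ a

      α≤n : α N.≤ n
      α≤n = N.s≤s⁻¹ (Fin.toℕ<n a)

    tail : ℕ → ℤ
    tail i = mismatches i t (place α)

    tail≤k : ∀ {i} → α N.≤ i → tail i ≤ + k
    tail≤k α≤i = ℤ.≤-trans (mismatches-anti t (place α) α≤i) dist-a

    +∣tail∣ : ∀ i → + ∣ tail i ∣ ≡ tail i
    +∣tail∣ i = ℤ.0≤i⇒+∣i∣≡i (0≤mismatches i t (place α))

    tail-stairs : ∃ λ (bs : Vec (Fin (suc n)) N) → ∀ i → α N.≤ i →
                  + N * tail i ≤ + above bs i * + k × + above bs i * + k ≤ + N * tail i + + k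
    tail-stairs =
      -- Left of α the tail may exceed k, hence the truncation α ⊔ i.
      let bs , spec = staircase n k N (λ i → N N.* ∣ tail (α N.⊔ i) ∣) anti end bound
      in bs , λ i α≤i →
        subst₂ _≤_ (N*tail α≤i) (ℤ.pos-* (above bs i) k) (+≤+ (proj₁ (spec i))) ,
        subst₂ _≤_ (ℤ.pos-* (above bs i) k) (cong (_+ + k) (N*tail α≤i)) (+≤+ (proj₂ (spec i)))
      where
      anti : ∀ i → N N.* ∣ tail (α N.⊔ suc i) ∣ N.≤ N N.* ∣ tail (α N.⊔ i) ∣
      anti i = ℕ.*-monoʳ-≤ N (ℤ.drop‿+≤+ (subst₂ _≤_ (sym (+∣tail∣ (α N.⊔ suc i))) (sym (+∣tail∣ (α N.⊔ i)))
        (mismatches-anti t (place α) (ℕ.⊔-monoʳ-≤ α (ℕ.n≤1+n i)))))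
      end : N N.* ∣ tail (α N.⊔ n) ∣ ≡ 0
      end = trans (cong (λ j → N N.* ∣ tail j ∣) (ℕ.m≤n⇒m⊔n≡n α≤n))
        (trans (cong (λ z → N N.* ∣ z ∣) (mismatches-n t (place α))) (ℕ.*-zeroʳ N))
      bound : ∀ i → N N.* ∣ tail (α N.⊔ i) ∣ N.≤ N N.* k
      bound i = ℕ.*-monoʳ-≤ N (ℤ.drop‿+≤+ (subst (_≤ + k) (sym (+∣tail∣ (α N.⊔ i))) (tail≤k (ℕ.m≤m⊔n α i))))
      N*tail : ∀ {i} → α N.≤ i → + (N N.* ∣ tail (α N.⊔ i) ∣) ≡ + N * tail i
      N*tail {i} α≤i = trans (cong (λ j → + (N N.* ∣ tail j ∣)) (ℕ.m≤n⇒m⊔n≡n α≤i))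
                         (trans (ℤ.pos-* N ∣ tail i ∣) (cong (+ N *_) (+∣tail∣ i)))

    residue : ℕ × A → ℤ
    residue = diff α (place α) t

    -- `norm-diff` gives `2 k`; relaxing it to the bound `4 k` of the offsets makes the step budget
    -- after scaling exactly `N * N`.
    norm-residue : ⟨ residue , residue ⟩ ≤ + (4 N.* k)
    norm-residue = ℤ.≤-trans (norm-diff α (place α) t (place∈S α))
      (ℤ.≤-trans (ℤ.*-monoˡ-≤-nonNeg (+ 2) dist-a)
        (subst (_≤ + (4 N.* k)) (ℤ.pos-* 2 k) (+≤+ (ℕ.*-monoˡ-≤ k (N.s≤s (N.s≤s (N.z≤n {2})))))))

    -- Compressing `N` times the residue divides the error per inner product by `N`, at the price of
    -- `N * N` steps.
    scaled : ℕ × A → ℤ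
    scaled x = + N * residue x

    norm-scaled : ⟨ scaled , scaled ⟩ ≤ + (N N.* N) * + (4 N.* k)
    norm-scaled = subst (_≤ + (N N.* N) * + (4 N.* k)) (sym expand)
      (ℤ.*-monoˡ-≤-nonNeg (+ (N N.* N)) norm-residue)
      where
      open ≡-Reasoning
      expand : ⟨ scaled , scaled ⟩ ≡ + (N N.* N) * ⟨ residue , residue ⟩
      expand = begin
        ⟨ scaled , scaled ⟩                  ≡⟨ ip-scale (+ N) residue scaled ⟩
        + N * ⟨ residue , scaled ⟩           ≡⟨ cong (+ N *_) (trans (ip-comm residue scaled) (ip-scale (+ N) residue residue)) ⟩
        + N * (+ N * ⟨ residue , residue ⟩)  ≡⟨ ℤ.*-assoc (+ N) (+ N) _ ⟨
        + N * + N * ⟨ residue , residue ⟩    ≡⟨ cong (_* ⟨ residue , residue ⟩) (ℤ.pos-* N N) ⟨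
        + (N N.* N) * ⟨ residue , residue ⟩  ∎

    norm-offset : ∀ i → Near k α i → ⟨ offset α i , offset α i ⟩ ≤ + (4 N.* k)
    norm-offset i near = ℤ.≤-trans (norm-diff (toℕ i) (place (toℕ i)) (place α) (place∈S (toℕ i)))
      (ℤ.≤-trans (ℤ.*-monoˡ-≤-nonNeg (+ 2) (proj₂ near))
        (ℤ.≤-reflexive (trans (sym (ℤ.*-assoc (+ 2) (+ 2) (+ k))) (sym (ℤ.pos-* 4 k)))))

    residue-compressed : ∃ λ (st : Vec (Fin (suc n) × Bool) (N N.* N)) → ∀ i → Near k α i →
                         ∣ + N * ⟨ residue , offset α i ⟩ - combination (offset α) st (offset α i) ∣ N.≤ 4 N.* k
    residue-compressed =
      let st , close = compress (offset α) (4 N.* k) (near? k α) norm-offset (fromℕ n) offset-n-null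
                         (N N.* N) scaled norm-scaled
      in st , λ i near → subst (λ z → ∣ z - combination (offset α) st (offset α i) ∣ N.≤ 4 N.* k)
                           (ip-scale (+ N) residue (offset α i)) (close i near)
      where
      offset-n-null : ∀ w → ⟨ offset α (fromℕ n) , w ⟩ ≡ 0ℤ
      offset-n-null w = subst (λ j → ⟨ diff j (place j) (place α) , w ⟩ ≡ 0ℤ) (sym (Fin.toℕ-fromℕ n))
                          (diff-n-null (place n) (place α) w)

    -- Triangle inequality through the text: from position `i` on, both placed patterns are within
    -- `k` mismatches of `t`.
    dist≤k⇒near : (∀ i → distance t i ≤ + k → α N.≤ i) → ∀ i → distance t (toℕ i) ≤ + k → Near k α i
    dist≤k⇒near first i dist≤k = first (toℕ i) dist≤k ,
      ℤ.≤-trans (mismatches-triangle (toℕ i) (place α) (place (toℕ i)) t)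
        (ℤ.≤-trans (ℤ.+-mono-≤ dist≤k (tail≤k (first (toℕ i) dist≤k))) (ℤ.≤-reflexive (double (+ k))))
      where
      double : ∀ k → k + k ≡ + 2 * k
      double = solve-∀

    module _ (i : Fin (suc n)) (c W : ℤ) (near : Near k α i)
             (stair : + N * tail (toℕ i) ≤ c * + k × c * + k ≤ + N * tail (toℕ i) + + k)
             (err : ∣ + N * ⟨ residue , offset α i ⟩ - W ∣ N.≤ 4 N.* k) where

      private
        D = distance t (toℕ i)
        M = tail (toℕ i)
        G = mismatches (toℕ i) (place α) (place (toℕ i))
        w = ⟨ residue , offset α i ⟩
        V = + (4 N.* k)

        D≡ : D ≡ M + G + w
        D≡ = ip-diff t (place (toℕ i)) (place α) (proj₁ near) (place∈S (toℕ i)) (place∈S α)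

      -- After splitting `D` by `ip-diff`, the staircase only rounds up, and the shift `V` covers
      -- the difference between `N * w` and `W`.
      estimate-lower : + N * D ≤ c * + k + + N * G + W + V
      estimate-lower = ≤-by (0≤+ (gap (proj₁ stair)) (gap (∣∣≤⇒≤ (+ N * w - W) err)))
        (trans (arith (+ N) M G w (c * + k) W V)
          (cong (λ d → + N * d + (c * + k - + N * M + (V - (+ N * w - W)))) (sym D≡)))
        where
        arith : ∀ n m g w s W v → s + n * g + W + v ≡ n * (m + g + w) + (s - n * m + (v - (n * w - W)))
        arith = solve-∀

      estimate-upper : c * + k + + N * G + W + V ≤ + N * D + + 9 * + k
      estimate-upper = ≤-by (0≤+ (gap (proj₂ stair)) (∣∣≤⇒0≤+ (+ N * w - W) err))
        (trans (cong (λ d → + N * d + + 9 * + k) D≡) (trans (arith (+ N) M G w (c * + k) W (+ k))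
          (cong (λ v → c * + k + + N * G + W + v + (+ N * M + + k - c * + k + (v + (+ N * w - W)))) (sym (ℤ.pos-* 4 k)))))
        where
        arith : ∀ n m g w s W k → n * (m + g + w) + + 9 * k
                ≡ s + n * g + W + + 4 * k + (n * m + k - s + (+ 4 * k + (n * w - W)))
        arith = solve-∀

  sketch : ∀ N k t → ∃ λ (sk : Sketch n N) → ∀ i → Faithful N k (distance t (toℕ i)) (estimate k sk i)
  sketch N k t =
    -- At alignment `n` the pattern covers nothing of the first half, so the distance is 0 and the
    -- search succeeds.
    let a , dist-a , first = least (λ i → distance t i ℤ.≤? + k) n
                               (subst (_≤ + k) (sym (mismatches-n t (place n))) (+≤+ N.z≤n))
        bs , stairs = tail-stairs N k t a dist-a
        st , close  = residue-compressed N k t a dist-a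
    in (a , bs , st) , λ i → faithful a dist-a first bs stairs st close i (near? k (toℕ a) i)
    where
    faithful : ∀ a dist-a → (∀ i → distance t i ≤ + k → toℕ a N.≤ i) →
      ∀ bs → (∀ i → toℕ a N.≤ i → + N * tail N k t a dist-a i ≤ + above bs i * + k
                                  × + above bs i * + k ≤ + N * tail N k t a dist-a i + + k) →
      ∀ st → (∀ i → Near k (toℕ a) i → ∣ + N * ⟨ residue N k t a dist-a , offset (toℕ a) i ⟩
                                         - combination (offset (toℕ a)) st (offset (toℕ a) i) ∣ N.≤ 4 N.* k) →
      ∀ i (d : Dec (Near k (toℕ a) i)) → Faithful N k (distance t (toℕ i)) (estimate-if k (a , bs , st) i d)
    faithful a dist-a first bs stairs st close i (yes near) =
      estimate-lower N k t a dist-a i (+ above bs (toℕ i)) _ near (stairs (toℕ i) (proj₁ near)) (close i near) ,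
      λ _ → estimate-upper N k t a dist-a i (+ above bs (toℕ i)) _ near (stairs (toℕ i) (proj₁ near)) (close i near)
    faithful a dist-a first bs stairs st close i (no far) =
      ℤ.*-monoˡ-≤-nonNeg (+ N) (mismatches≤n (toℕ i) t (place (toℕ i))) ,
      λ dist≤k → ⊥-elim (far (dist≤k⇒near N k t a dist-a first i dist≤k))

-- Hamming distances of lists as masked sums over positions.

look : ∀ {A : Set} → A → List A → ℕ → A
look d []       q       = d
look d (x ∷ xs) zero    = x
look d (x ∷ xs) (suc q) = look d xs q

look∈ : ∀ {A : Set} {d : A} {ys} xs → d ∈ ys → (∀ {x} → x ∈ xs → x ∈ ys) → ∀ q → look d xs q ∈ ys
look∈ []       d∈ xs⊆ q       = d∈
look∈ (x ∷ xs) d∈ xs⊆ zero    = xs⊆ (here refl)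
look∈ (x ∷ xs) d∈ xs⊆ (suc q) = look∈ xs d∈ (λ x∈ → xs⊆ (there x∈)) q

drop-++ˡ : ∀ {A : Set} i (xs ys : List A) → i N.≤ length xs → List.drop i (xs List.++ ys) ≡ List.drop i xs List.++ ys
drop-++ˡ zero    xs       ys _           = refl
drop-++ˡ (suc i) (x ∷ xs) ys (N.s≤s i≤) = drop-++ˡ i xs ys i≤

module _ {A : Set} (_≟_ : DecidableEquality A) where

  open Indicator _≟_

  hamming-split : ∀ P xs ys → length xs N.≤ length P →
    hamming _≟_ P (List.take (length P) (xs List.++ ys))
    ≡ hamming _≟_ (List.take (length xs) P) xs
      N.+ hamming _≟_ (List.drop (length xs) P) (List.take (length P N.∸ length xs) ys)
  hamming-split P       []       ys _ = refl
  hamming-split (p ∷ P) (x ∷ xs) ys (N.s≤s le) with p ≟ x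
  ... | yes _ = hamming-split P xs ys le
  ... | no  _ = cong suc (hamming-split P xs ys le)

  hamming-∷ : ∀ p P t T → + hamming _≟_ (p ∷ P) (t ∷ T) ≡ mis t p + + hamming _≟_ P T
  hamming-∷ p P t T with p ≟ t | t ≟ p
  ... | yes _    | yes _   = refl
  ... | yes refl | no t≢p  = ⊥-elim (t≢p refl)
  ... | no p≢t   | yes refl = ⊥-elim (p≢t refl)
  ... | no _     | no _    = refl

  -- Removing the first letter of `T` lowers `i` and each `q` by one, which changes neither the mask
  -- nor `q ∸ i`; the term at position 0 is masked as long as `i` is positive.
  hamming-∑ : ∀ d i P T → length T N.≤ length P →
    + hamming _≟_ (List.take (length (List.drop i T)) P) (List.drop i T)
    ≡ ∑ (upTo (length T)) (λ q → χ i q * mis (look d T q) (look d P (q N.∸ i)))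
  hamming-∑ d zero    P       []      _          = refl
  hamming-∑ d zero    (p ∷ P) (t ∷ T) (N.s≤s le) = begin
    + hamming _≟_ (p ∷ List.take (length T) P) (t ∷ T)
      ≡⟨ hamming-∷ p _ t T ⟩
    mis t p + + hamming _≟_ (List.take (length T) P) T
      ≡⟨ cong₂ _+_ (sym (ℤ.*-identityˡ (mis t p))) (hamming-∑ d zero P T le) ⟩
    1ℤ * mis t p + ∑ (upTo (length T)) (λ q → 1ℤ * mis (look d T q) (look d P q))
      ≡⟨ ∑-upTo-suc (length T) (λ q → 1ℤ * mis (look d (t ∷ T) q) (look d (p ∷ P) q)) ⟨
    ∑ (upTo (suc (length T))) (λ q → 1ℤ * mis (look d (t ∷ T) q) (look d (p ∷ P) q)) ∎
    where open ≡-Reasoning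
  hamming-∑ d (suc i) P       []      _          = refl
  hamming-∑ d (suc i) P       (t ∷ T) le         = begin
    + hamming _≟_ (List.take (length (List.drop i T)) P) (List.drop i T)
      ≡⟨ hamming-∑ d i P T (ℕ.≤-trans (ℕ.n≤1+n _) le) ⟩
    ∑ (upTo (length T)) (λ q → χ i q * mis (look d T q) (look d P (q N.∸ i)))
      ≡⟨ ℤ.+-identityˡ _ ⟨
    0ℤ + ∑ (upTo (length T)) (λ q → χ i q * mis (look d T q) (look d P (q N.∸ i)))
      ≡⟨ cong (_+ ∑ (upTo (length T)) (λ q → χ i q * mis (look d T q) (look d P (q N.∸ i)))) (ℤ.*-zeroˡ (mis t (look d P 0))) ⟨
    0ℤ * mis t (look d P 0) + ∑ (upTo (length T)) (λ q → χ i q * mis (look d T q) (look d P (q N.∸ i)))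
      ≡⟨ ∑-upTo-suc (length T) (λ q → χ (suc i) q * mis (look d (t ∷ T) q) (look d P (q N.∸ suc i))) ⟨
    ∑ (upTo (suc (length T))) (λ q → χ (suc i) q * mis (look d (t ∷ T) q) (look d P (q N.∸ suc i))) ∎
    where open ≡-Reasoning

-- Rational approximation and the count of message bits.

toℚᵘ-/ : ∀ i n .{{_ : N.NonZero n}} → toℚᵘ (i Q./ n) U.≃ i U./ n
toℚᵘ-/ i (suc n) = ℚ.toℚᵘ-fromℚᵘ (U.mkℚᵘ i n)

-- The hypothesis on `E` says `1 / E ≤ ε`. Dividing the additive error `18 h` by `N = 18 E` leaves
-- `h / E`, at most `ε h`.
isApprox-/ : ∀ ε N E h Y .{{_ : N.NonZero N}} → N ≡ 18 N.* E → Q.↧ ε ≤ Q.↥ ε * + E →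
             + N * + h ≤ Y → Y ≤ + N * + h + + 18 * + h → IsApprox ε h (Y Q./ N)
isApprox-/ ε@(mkℚ p q-1 _) N@(suc _) E h Y N≡ q≤pE lo hi =
  ℚ.toℚᵘ-cancel-≤ (ℚᵘ.≤-respˡ-≃ (ℚᵘ.≃-sym (toℚᵘ-/ (+ h) 1)) (ℚᵘ.≤-respʳ-≃ (ℚᵘ.≃-sym (toℚᵘ-/ Y N))
    (U.*≤* (subst₂ _≤_ (ℤ.*-comm (+ N) (+ h)) (sym (ℤ.*-identityʳ Y)) lo)))) ,
  ℚ.toℚᵘ-cancel-≤ (ℚᵘ.≤-respˡ-≃ (ℚᵘ.≃-sym (toℚᵘ-/ Y N)) (ℚᵘ.≤-respʳ-≃ (ℚᵘ.≃-sym rhs)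
    (U.*≤* bound)))
  where
  q = suc q-1
  rhs : toℚᵘ ((1ℚ Q.+ ε) Q.* toℚ h) U.≃ (U.1ℚᵘ U.+ toℚᵘ ε) U.* (+ h U./ 1)
  rhs = ℚᵘ.≃-trans (ℚ.toℚᵘ-homo-* (1ℚ Q.+ ε) (toℚ h)) (ℚᵘ.*-cong (ℚ.toℚᵘ-homo-+ 1ℚ ε) (toℚᵘ-/ (+ h) 1))
  arith : ∀ h Y p q E → (1ℤ * q + p * 1ℤ) * h * (+ 18 * E)
          ≡ Y * q + ((+ 18 * E * h + + 18 * h - Y) * q + + 18 * (h * (p * E - q)))
  arith = solve-∀
  +N≡ : + N ≡ + 18 * + E
  +N≡ = trans (cong +_ N≡) (ℤ.pos-* 18 E)
  core : Y * + q ≤ (1ℤ * + q + p * 1ℤ) * + h * (+ 18 * + E)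
  core = ≤-by (0≤+ (0≤* (gap (subst (λ n → Y ≤ n * + h + + 18 * + h) +N≡ hi)) (+≤+ (N.z≤n {q})))
                   (0≤* (+≤+ (N.z≤n {18})) (0≤* (+≤+ (N.z≤n {h})) (gap q≤pE))))
              (arith (+ h) Y p (+ q) (+ E))
  bound : Y * + (1 N.* q N.* 1) ≤ (1ℤ * + q + p * 1ℤ) * + h * + N
  bound = subst₂ _≤_ (cong (λ d → Y * + d) (sym (trans (ℕ.*-identityʳ (1 N.* q)) (ℕ.*-identityˡ q))))
            (cong ((1ℤ * + q + p * 1ℤ) * + h *_) (sym +N≡)) core

ε⁴-bound : ∀ ε p L C M → Q.↥ ε ≡ + p → p N.* p N.* p N.* p N.* L N.≤ C N.* M N.* (Q.↧ₙ ε N.* Q.↧ₙ ε N.* Q.↧ₙ ε N.* Q.↧ₙ ε) →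
           (ε Q.* ε Q.* ε Q.* ε) Q.* toℚ L Q.≤ toℚ C Q.* toℚ M
ε⁴-bound ε@(mkℚ (+ p) q-1 _) .p L C M refl le =
  ℚ.toℚᵘ-cancel-≤ (ℚᵘ.≤-respˡ-≃ (ℚᵘ.≃-sym lhs) (ℚᵘ.≤-respʳ-≃ (ℚᵘ.≃-sym rhs) (U.*≤* bound)))
  where
  q = suc q-1
  lhs : toℚᵘ ((ε Q.* ε Q.* ε Q.* ε) Q.* toℚ L) U.≃ (toℚᵘ ε U.* toℚᵘ ε U.* toℚᵘ ε U.* toℚᵘ ε) U.* (+ L U./ 1)
  lhs = ℚᵘ.≃-trans (ℚ.toℚᵘ-homo-* (ε Q.* ε Q.* ε Q.* ε) (toℚ L)) (ℚᵘ.*-cong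
    (ℚᵘ.≃-trans (ℚ.toℚᵘ-homo-* (ε Q.* ε Q.* ε) ε) (ℚᵘ.*-congʳ
      (ℚᵘ.≃-trans (ℚ.toℚᵘ-homo-* (ε Q.* ε) ε) (ℚᵘ.*-congʳ (ℚ.toℚᵘ-homo-* ε ε)))))
    (toℚᵘ-/ (+ L) 1))
  rhs : toℚᵘ (toℚ C Q.* toℚ M) U.≃ (+ C U./ 1) U.* (+ M U./ 1)
  rhs = ℚᵘ.≃-trans (ℚ.toℚᵘ-homo-* (toℚ C) (toℚ M)) (ℚᵘ.*-cong (toℚᵘ-/ (+ C) 1) (toℚᵘ-/ (+ M) 1))
  pos : ∀ {i j} m n → + m ≡ i → + n ≡ j → + (m N.* n) ≡ i * j
  pos m n refl refl = ℤ.pos-* m n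
  bound : (+ p * + p * + p * + p) * + L * + 1 ≤ + C * + M * + (q N.* q N.* q N.* q N.* 1)
  bound = subst₂ _≤_
    (trans (pos (p N.* p N.* p N.* p) L (pos (p N.* p N.* p) p (pos (p N.* p) p (ℤ.pos-* p p) refl) refl) refl)
      (sym (ℤ.*-identityʳ _)))
    (pos (C N.* M) (q N.* q N.* q N.* q N.* 1) (ℤ.pos-* C M) refl)
    (+≤+ (subst (λ d → p N.* p N.* p N.* p N.* L N.≤ C N.* M N.* d) (sym (ℕ.*-identityʳ _)) le))

-- There are at most `4 ℓ` scales, and a sketch takes at most `(2 ℓ + 2 ℓ + 3 ℓ) * (N * N)` bits;
-- hence 28 = 4 * 7.
message-length≤ : ∀ ℓ N .{{_ : N.NonZero ℓ}} .{{_ : N.NonZero N}} → let b = ℓ N.+ ℓ in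
  (2 N.+ b) N.* (b N.+ (N N.* b N.+ N N.* N N.* (b N.+ 1))) N.≤ 28 N.* (ℓ N.* ℓ) N.* (N N.* N)
message-length≤ ℓ N = begin
  (2 N.+ b) N.* (b N.+ (N N.* b N.+ N N.* N N.* (b N.+ 1)))
    ≤⟨ ℕ.*-mono-≤ (ℕ.+-monoˡ-≤ b (ℕ.*-monoʳ-≤ 2 1≤ℓ))
         (ℕ.+-mono-≤ (ℕ.m≤n*m b (N N.* N) {{ℕ.m*n≢0 N N}})
           (ℕ.+-mono-≤ (ℕ.*-monoˡ-≤ b (ℕ.m≤m*n N N)) (ℕ.*-monoʳ-≤ (N N.* N) (ℕ.+-monoʳ-≤ b 1≤ℓ)))) ⟩
  (2 N.* ℓ N.+ b) N.* (N N.* N N.* b N.+ (N N.* N N.* b N.+ N N.* N N.* (b N.+ ℓ)))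
    ≡⟨ arith ℓ (N N.* N) ⟩
  28 N.* (ℓ N.* ℓ) N.* (N N.* N) ∎
  where
  open ℕ.≤-Reasoning
  b = ℓ N.+ ℓ
  1≤ℓ : 1 N.≤ ℓ
  1≤ℓ = N.>-nonZero⁻¹ ℓ
  arith : ∀ ℓ M → (2 N.* ℓ N.+ (ℓ N.+ ℓ)) N.* (M N.* (ℓ N.+ ℓ) N.+ (M N.* (ℓ N.+ ℓ) N.+ M N.* (ℓ N.+ ℓ N.+ ℓ))) ≡ 28 N.* (ℓ N.* ℓ) N.* M
  arith = ℕSolver.solve-∀

-- Two of the four factors `p` cancel `E * E` through `p E ≤ 2 q`. The other two are merely bounded
-- by `q`; this is the slack between ε⁻² and ε⁻⁴.
p⁴L-bound : ∀ p q E c s M L → p N.≤ q → p N.* E N.≤ 2 N.* q → L N.≤ c N.* M N.* (s N.* E N.* (s N.* E)) →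
            p N.* p N.* p N.* p N.* L N.≤ c N.* (s N.* s N.* 4) N.* M N.* (q N.* q N.* q N.* q)
p⁴L-bound p q E c s M L p≤q pE≤2q L≤ = begin
  p N.* p N.* p N.* p N.* L
    ≤⟨ ℕ.*-monoʳ-≤ (p N.* p N.* p N.* p) L≤ ⟩
  p N.* p N.* p N.* p N.* (c N.* M N.* (s N.* E N.* (s N.* E)))
    ≡⟨ regroup p E c s M ⟩
  c N.* (s N.* s) N.* M N.* (p N.* p N.* (p N.* E N.* (p N.* E)))
    ≤⟨ ℕ.*-monoʳ-≤ (c N.* (s N.* s) N.* M) (ℕ.*-mono-≤ (ℕ.*-mono-≤ p≤q p≤q) (ℕ.*-mono-≤ pE≤2q pE≤2q)) ⟩
  c N.* (s N.* s) N.* M N.* (q N.* q N.* (2 N.* q N.* (2 N.* q)))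
    ≡⟨ collect q c s M ⟩
  c N.* (s N.* s N.* 4) N.* M N.* (q N.* q N.* q N.* q) ∎
  where
  open ℕ.≤-Reasoning
  regroup : ∀ p E c s M → p N.* p N.* p N.* p N.* (c N.* M N.* (s N.* E N.* (s N.* E)))
            ≡ c N.* (s N.* s) N.* M N.* (p N.* p N.* (p N.* E N.* (p N.* E)))
  regroup = ℕSolver.solve-∀
  collect : ∀ q c s M → c N.* (s N.* s) N.* M N.* (q N.* q N.* (2 N.* q N.* (2 N.* q)))
            ≡ c N.* (s N.* s N.* 4) N.* M N.* (q N.* q N.* q N.* q)
  collect = ℕSolver.solve-∀

-- For ε = `p / q` this provides an integer between 1/ε and 2/ε, namely the rounded-down quotient
-- plus one.
reciprocal : ∀ p q .{{_ : N.NonZero p}} → p N.≤ q → ∃ λ e → q N.≤ p N.* suc e × p N.* suc e N.≤ 2 N.* q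
reciprocal p q p≤q = q DM./ p , lower , upper
  where
  open ℕ.≤-Reasoning
  lower : q N.≤ p N.* suc (q DM./ p)
  lower = begin
    q                                   ≡⟨ DM.m≡m%n+[m/n]*n q p ⟩
    q DM.% p N.+ q DM./ p N.* p         ≤⟨ ℕ.+-monoˡ-≤ _ (ℕ.<⇒≤ (DM.m%n<n q p)) ⟩
    p N.+ q DM./ p N.* p                ≡⟨ ℕ.*-comm (suc (q DM./ p)) p ⟩
    p N.* suc (q DM./ p)                ∎
  upper : p N.* suc (q DM./ p) N.≤ 2 N.* q
  upper = begin
    p N.* suc (q DM./ p)                ≡⟨ ℕ.*-comm p (suc (q DM./ p)) ⟩
    p N.+ q DM./ p N.* p                ≤⟨ ℕ.+-mono-≤ p≤q (DM.m/n*n≤m q p) ⟩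
    q N.+ q                             ≡⟨ cong (q N.+_) (ℕ.+-identityʳ q) ⟨
    2 N.* q                             ∎

-- An alignment takes `n + 1` values, too many for ⌈log₂ n⌉ bits when `n` is a power of two.
-- Doubling the number of bits leaves room.
n<2^2⌈log₂n⌉ : ∀ n ℓ → 2 N.≤ n → n N.≤ 2 N.^ ℓ → suc n N.≤ 2 N.^ (ℓ N.+ ℓ)
n<2^2⌈log₂n⌉ n ℓ 2≤n n≤2^ℓ = begin
  1 N.+ n                ≤⟨ ℕ.+-monoˡ-≤ n (ℕ.≤-trans (N.s≤s N.z≤n) 2≤n) ⟩
  n N.+ n                ≡⟨ cong (n N.+_) (ℕ.+-identityʳ n) ⟨
  2 N.* n                ≤⟨ ℕ.*-mono-≤ (ℕ.≤-trans 2≤n n≤2^ℓ) n≤2^ℓ ⟩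
  2 N.^ ℓ N.* 2 N.^ ℓ    ≡⟨ ℕ.^-distribˡ-+-* 2 ℓ ℓ ⟨
  2 N.^ (ℓ N.+ ℓ)        ∎
  where open ℕ.≤-Reasoning

-- The protocol, its correctness and its cost.

minimum : ∀ {J} → (Fin (suc J) → ℤ) → ℤ
minimum {zero}  f = f zero
minimum {suc J} f = f zero ⊓ minimum (λ j → f (suc j))

≤-minimum : ∀ {J} (f : Fin (suc J) → ℤ) {x} → (∀ j → x ≤ f j) → x ≤ minimum f
≤-minimum {zero}  f x≤ = x≤ zero
≤-minimum {suc J} f x≤ = ℤ.⊓-glb (x≤ zero) (≤-minimum (λ j → f (suc j)) (λ j → x≤ (suc j)))

minimum-≤ : ∀ {J} (f : Fin (suc J) → ℤ) j → minimum f ≤ f j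
minimum-≤ {zero}  f zero    = ℤ.≤-refl
minimum-≤ {suc J} f zero    = ℤ.i⊓j≤i (f zero) _
minimum-≤ {suc J} f (suc j) = ℤ.≤-trans (ℤ.i⊓j≤j (f zero) _) (minimum-≤ (λ j → f (suc j)) j)

count-all : ∀ {R} {P : Fin R → Set} (P? : Decidable P) → (∀ r → P r) → count P? ≡ R
count-all {R} P? all = trans
  (cong length (List.filter-all P? {List.allFin R} (All.tabulate (λ {r} _ → all r))))
  (List.length-tabulate {n = R} (λ r → r))

correct⇒succeeds : ∀ {A : Set} (_≟_ : DecidableEquality A) {n R L} ε (Π : OneWayProtocol A n R L) →
                   (∀ T₁ T₂ P r → Correct _≟_ ε Π T₁ T₂ P r) → Succeeds _≟_ ε Π
correct⇒succeeds _≟_ {R = R} ε Π correct T₁ T₂ P =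
  subst (λ c → 2 N.* R N.≤ 3 N.* c) (sym (count-all (correct? _≟_ ε Π T₁ T₂ P) (correct T₁ T₂ P)))
    (ℕ.*-monoˡ-≤ R (N.s≤s (N.s≤s (N.z≤n {1}))))

module Protocol {A : Set} (_≟_ : DecidableEquality A) (m N b : ℕ) .{{N≢0 : N.NonZero N}}
                (fits : suc (suc m) N.≤ 2 N.^ b) where

  private n = suc m

  Message : Set
  Message = Vec (Sketch n N) (2 N.+ b)

  message-code : Code Message ((2 N.+ b) N.* (b N.+ (N N.* b N.+ N N.* N N.* (b N.+ 1))))
  message-code = vec-code (2 N.+ b)
    (index ×-code vec-code N index ×-code vec-code (N N.* N) (index ×-code bool-code))
    where index = fin-code {n} {b} fits

  -- The default `head P` keeps every value of `letter P P` among the symbols of the pattern, even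
  -- past its end.
  letter : Vec A n → Vec A n → ℕ → A
  letter P xs = look (head P) (toList xs)

  symbols : Vec A n → List A
  symbols P = deduplicate _≟_ (toList P)

  letter∈symbols : ∀ P q → letter P P q ∈ symbols P
  letter∈symbols P@(_ ∷ _) = look∈ (toList P) (∈-deduplicate⁺ _≟_ {toList P} (here refl)) (∈-deduplicate⁺ _≟_ {toList P})

  module Level (P : Vec A n) =
    LevelSketch _≟_ n (symbols P) (deduplicate-! _≟_ (toList P)) (letter P P) (letter∈symbols P)

  message : Vec A n → Vec A n → Message
  message T₁ P = tabulate (λ j → proj₁ (Level.sketch P N (level (toℕ j)) (letter P T₁)))

  prefix-estimate : Message → Vec A n → Fin (suc n) → ℤ
  prefix-estimate ms P i = minimum (λ j → Level.estimate P (level (toℕ j)) (lookup ms j) i)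

  -- For `i ≤ n` the length `n ∸ (n ∸ i)` is `i`; the unsimplified form matches `hamming-split`.
  suffix-distance : Vec A n → Vec A n → ℕ → ℕ
  suffix-distance T₂ P i =
    hamming _≟_ (List.drop (n N.∸ i) (toList P)) (List.take (n N.∸ (n N.∸ i)) (toList T₂))

  protocol : OneWayProtocol A n 1 ((2 N.+ b) N.* (b N.+ (N N.* b N.+ N N.* N N.* (b N.+ 1))))
  protocol = record
    { alice = λ _ T₁ P → encode message-code (message T₁ P)
    ; bob   = λ _ bits T₂ P i →
        (prefix-estimate (decode message-code bits) P i + + N * + suffix-distance T₂ P (toℕ i)) Q./ N
    }

  module _ (T₁ T₂ P : Vec A n) where

    prefix-distance : ℕ → ℕ
    prefix-distance i = hamming _≟_ (List.take (n N.∸ i) (toList P)) (List.drop i (toList T₁))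

    window-distance : ∀ i → i N.≤ n →
      hamming _≟_ (toList P) (window n i (toList (T₁ ++ T₂))) ≡ prefix-distance i N.+ suffix-distance T₂ P i
    window-distance i i≤n = begin
      hamming _≟_ p (List.take n (List.drop i (toList (T₁ ++ T₂))))
        ≡⟨ cong (λ t → hamming _≟_ p (List.take n (List.drop i t))) (Vec.toList-++ T₁ T₂) ⟩
      hamming _≟_ p (List.take n (List.drop i (t List.++ toList T₂)))
        ≡⟨ cong (λ t → hamming _≟_ p (List.take n t)) (drop-++ˡ i t (toList T₂) (subst (i N.≤_) (sym |t|) i≤n)) ⟩
      hamming _≟_ p (List.take n (List.drop i t List.++ toList T₂))
        ≡⟨ split n (n N.∸ i) (Vec.length-toList P) (trans (List.length-drop i t) (cong (N._∸ i) |t|)) (ℕ.m∸n≤m n i) ⟩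
      prefix-distance i N.+ suffix-distance T₂ P i ∎
      where
      open ≡-Reasoning
      p = toList P
      t = toList T₁
      |t| : length t ≡ n
      |t| = Vec.length-toList T₁
      -- The lengths are variables here so that their equations can be matched with `refl`.
      split : ∀ l l′ → length p ≡ l → length (List.drop i t) ≡ l′ → l′ N.≤ l →
        hamming _≟_ p (List.take l (List.drop i t List.++ toList T₂))
        ≡ hamming _≟_ (List.take l′ p) (List.drop i t) N.+ hamming _≟_ (List.drop l′ p) (List.take (l N.∸ l′) (toList T₂))
      split _ _ refl refl = hamming-split _≟_ p (List.drop i t) (toList T₂)

    prefix-distance≡ : ∀ i → + prefix-distance i ≡ Level.distance P (letter P T₁) i
    prefix-distance≡ i = go n (n N.∸ i) (Vec.length-toList T₁)
      (trans (List.length-drop i t) (cong (N._∸ i) (Vec.length-toList T₁)))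
      where
      p = toList P
      t = toList T₁
      open Indicator _≟_
      go : ∀ l l′ → length t ≡ l → length (List.drop i t) ≡ l′ →
        + hamming _≟_ (List.take l′ p) (List.drop i t)
        ≡ ∑ (upTo l) (λ q → χ i q * mis (letter P T₁ q) (letter P P (q N.∸ i)))
      go _ _ refl refl = hamming-∑ _≟_ (head P) i p t
        (ℕ.≤-reflexive (trans (Vec.length-toList T₁) (sym (Vec.length-toList P))))

    -- Every scale gives an upper bound, and at a scale `k` with `d ≤ k ≤ 2 d` the error `9 k` is at
    -- most `18 d`.
    prefix-estimate-spec : ∀ i → let d = prefix-distance (toℕ i); e = prefix-estimate (message T₁ P) P i in
      + N * + d ≤ e × e ≤ + N * + d + + 18 * + d
    prefix-estimate-spec i = ≤-minimum _ lower , upper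
      where
      d = prefix-distance (toℕ i)
      E : Fin (2 N.+ b) → ℤ
      E j = Level.estimate P (level (toℕ j)) (lookup (message T₁ P) j) i
      faithful : ∀ j → Faithful N (level (toℕ j)) (+ d) (E j)
      faithful j = subst₂ (Faithful N (level (toℕ j))) (sym (prefix-distance≡ (toℕ i)))
        (cong (λ sk → Level.estimate P (level (toℕ j)) sk i)
          (sym (Vec.lookup∘tabulate (λ j → proj₁ (Level.sketch P N (level (toℕ j)) (letter P T₁))) j)))
        (proj₂ (Level.sketch P N (level (toℕ j)) (letter P T₁)) i)
      lower : ∀ j → + N * + d ≤ E j
      lower j = proj₁ (faithful j)
      d≤n : d N.≤ n
      d≤n = ℤ.drop‿+≤+ (subst (_≤ + n) (sym (prefix-distance≡ (toℕ i)))
        (Indicator.Geometry.mismatches≤n _≟_ n (symbols P) (deduplicate-! _≟_ (toList P)) (toℕ i) _ _))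
      upper : minimum E ≤ + N * + d + + 18 * + d
      upper = let j , d≤k , k≤2d = level-for b d (ℕ.≤-trans d≤n (ℕ.≤-trans (ℕ.n≤1+n n) fits)) in
        ℤ.≤-trans (minimum-≤ E j) (ℤ.≤-trans (proj₂ (faithful j) (+≤+ d≤k))
          (ℤ.+-monoʳ-≤ (+ N * + d) (subst₂ _≤_ (ℤ.pos-* 9 (level (toℕ j))) 18d
            (+≤+ (ℕ.*-monoʳ-≤ 9 k≤2d)))))
        where
        18d : + (9 N.* (2 N.* d)) ≡ + 18 * + d
        18d = trans (cong +_ (sym (ℕ.*-assoc 9 2 d))) (ℤ.pos-* 18 d)

    correct : ∀ ε e → N ≡ 18 N.* e → Q.↧ ε ≤ Q.↥ ε * + e → ∀ r → Correct _≟_ ε protocol T₁ T₂ P r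
    correct ε e N≡ 1/e≤ε r i = subst₂ (IsApprox ε)
      (sym (window-distance (toℕ i) (N.s≤s⁻¹ (Fin.toℕ<n i))))
      (cong (λ ms → (prefix-estimate ms P i + + N * + s) Q./ N) (sym (decode-encode message-code (message T₁ P))))
      (isApprox-/ ε N e (d N.+ s) (X + + N * + s) N≡ 1/e≤ε
        (≤-by (gap (proj₁ spec)) (lo (+ N) (+ d) (+ s) X))
        (≤-by (0≤+ (gap (proj₂ spec)) (0≤* (+≤+ (N.z≤n {18})) (+≤+ (N.z≤n {s})))) (hi (+ N) (+ d) (+ s) X)))
      where
      d = prefix-distance (toℕ i)
      s = suffix-distance T₂ P (toℕ i)
      X = prefix-estimate (message T₁ P) P i
      spec = prefix-estimate-spec i
      lo : ∀ n d s x → x + n * s ≡ n * (d + s) + (x - n * d)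
      lo = solve-∀
      hi : ∀ n d s x → n * (d + s) + + 18 * (d + s) ≡ x + n * s + (n * d + + 18 * d - x + + 18 * s)
      hi = solve-∀

  succeeds : ∀ ε e → N ≡ 18 N.* e → Q.↧ ε ≤ Q.↥ ε * + e → Succeeds _≟_ ε protocol
  succeeds ε e N≡ 1/e≤ε = correct⇒succeeds _≟_ ε protocol (λ T₁ T₂ P → correct T₁ T₂ P ε e N≡ 1/e≤ε)

theorem1 : Σ ℕ λ C → Σ ℕ λ n₀ →
    (ε : ℚ) → 0ℚ Q.< ε → ε Q.< ½ →
    (n : ℕ) → n₀ N.≤ n →
    (A : Set) (_≟_ : DecidableEquality A) →
    Σ ℕ λ R → Σ ℕ λ L → Σ (OneWayProtocol A n (suc R) L) λ Π →
    Succeeds _≟_ ε Π ×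
    ((ε Q.* ε Q.* ε Q.* ε) Q.* toℚ L Q.≤ toℚ C Q.* toℚ (⌈log₂ n ⌉ N.* ⌈log₂ n ⌉))
-- The factor 28 comes from `message-length≤`, the square of 18 from `N = 18 E`, and 4 from squaring
-- `p E ≤ 2 q`. Starting at `n = 2` makes the logarithm positive.
theorem1 = 28 N.* (18 N.* 18 N.* 4) , 2 , main
  where
  main : (ε : ℚ) → 0ℚ Q.< ε → ε Q.< ½ → (n : ℕ) → 2 N.≤ n → (A : Set) (_≟_ : DecidableEquality A) →
    Σ ℕ λ R → Σ ℕ λ L → Σ (OneWayProtocol A n (suc R) L) λ Π →
    Succeeds _≟_ ε Π ×
    ((ε Q.* ε Q.* ε Q.* ε) Q.* toℚ L Q.≤ toℚ (28 N.* (18 N.* 18 N.* 4)) Q.* toℚ (⌈log₂ n ⌉ N.* ⌈log₂ n ⌉))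
  main (mkℚ (+ zero)    q-1 _) (Q.*<* (Z.+<+ ())) _ _ _ _ _
  main (mkℚ Z.-[1+ _ ]  q-1 _) (Q.*<* ()) _ _ _ _ _
  main ε@(mkℚ (+ p@(suc _)) q-1 _) _ (Q.*<* 2p<q) n@(suc m) 2≤n A _≟_ =
    -- `R = 0` leaves a single random string, on which the output is always correct.
    0 , _ , protocol , succeeds ε (suc e) refl (subst (+ q ≤_) (ℤ.pos-* p (suc e)) (+≤+ q≤pe)) ,
    ε⁴-bound ε p _ (28 N.* (18 N.* 18 N.* 4)) (ℓ N.* ℓ) refl
      (p⁴L-bound p q (suc e) 28 18 (ℓ N.* ℓ) _ p≤q pe≤2q (message-length≤ ℓ N))
    where
    q = suc q-1
    ℓ = ⌈log₂ n ⌉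
    p≤q : p N.≤ q
    p≤q = ℕ.≤-trans (ℕ.m≤m*n p 2)
      (subst (p N.* 2 N.≤_) (ℕ.*-identityˡ q) (ℤ.drop‿+≤+ (subst₂ _≤_ (sym (ℤ.pos-* p 2)) (sym (ℤ.pos-* 1 q)) (ℤ.<⇒≤ 2p<q))))
    rec = reciprocal p q p≤q
    e = proj₁ rec
    q≤pe = proj₁ (proj₂ rec)
    pe≤2q = proj₂ (proj₂ rec)
    N = 18 N.* suc e
    instance
      N≢0 : N.NonZero N
      N≢0 = ℕ.m*n≢0 18 (suc e)
      ℓ≢0 : N.NonZero ℓ
      ℓ≢0 = N.>-nonZero (⌈log₂⌉-mono-≤ 2≤n)
    open Protocol _≟_ m N (ℓ N.+ ℓ) (n<2^2⌈log₂n⌉ n ℓ 2≤n (n≤2^⌈log₂n⌉ n))
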